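{- Let $n,k\ge 1$ and $m\ge 0$ be integers. The set of oscillating tableaux of length $n$ with height bounded by $k$ that start at the empty partition and end at the one-row shape $\lambda=(m)$ is in bijection with the set of standard Young tableaux of size $n$ with height at most $2k$ having exactly $m$ columns of odd length.
   Context: Partitions are identified with their Ferrers diagrams; the height of a diagram is its number of rows. An oscillating tableau of length $n$ is a sequence $(\lambda^{(0)},\lambda^{(1)},\dots,\lambda^{(n)})$ of Ferrers diagrams with $\lambda^{(0)}=\varnothing$ such that each $\lambda^{(i+1)}$ is obtained from $\lambda^{(i)}$ by adding exactly one box or deleting exactly one box. It has height bounded by $k$ if no diagram in the sequence has more than $k$ rows. The shape $(0)$ is the empty shape. -}

module Defs where

open import Data.Bool using (Bool; true; false; _∧_; _∨_; T)
open import Data.Nat using (ℕ; zero; suc; _≤ᵇ_; _<ᵇ_; _≡ᵇ_)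
open import Data.Nat.Properties using () renaming (_≟_ to _≟ℕ_)
open import Data.List using (List; []; _∷_; length; filter; concat; upTo; map; zipWith)
open import Data.Bool.ListAction using (all; and)
open import Data.List.Properties using (≡-dec)
open import Data.Vec using (Vec; toList)
open import Data.Product using (Σ)
open import Relation.Nullary.Decidable using (⌊_⌋)

-- Partitions / Ferrers diagrams, encoded as the list of row lengths
-- (λ₁ ≥ λ₂ ≥ … ≥ λ_ℓ > 0).  The empty diagram is [].

weaklyDecreasing : List ℕ → Bool
weaklyDecreasing []           = true
weaklyDecreasing (x ∷ [])     = true
weaklyDecreasing (x ∷ y ∷ r)  = (y ≤ᵇ x) ∧ weaklyDecreasing (y ∷ r)

isPartition : List ℕ → Bool
isPartition λ′ = all (λ x → 1 ≤ᵇ x) λ′ ∧ weaklyDecreasing λ′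

height : List ℕ → ℕ
height = length

_==ℓ_ : List ℕ → List ℕ → Bool
xs ==ℓ ys = ⌊ ≡-dec _≟ℕ_ xs ys ⌋

addsBox : List ℕ → List ℕ → Bool
addsBox []       []       = false
addsBox []       (y ∷ ys) = (y ≡ᵇ 1) ∧ (ys ==ℓ [])
addsBox (x ∷ xs) []       = false
addsBox (x ∷ xs) (y ∷ ys) = ((y ≡ᵇ suc x) ∧ (xs ==ℓ ys)) ∨ ((x ≡ᵇ y) ∧ addsBox xs ys)

oneStep : List ℕ → List ℕ → Bool
oneStep λ′ μ = addsBox λ′ μ ∨ addsBox μ λ′

oneRow : ℕ → List ℕ
oneRow zero    = []
oneRow (suc m) = suc m ∷ []

consecutiveSteps : List (List ℕ) → Bool
consecutiveSteps []            = true
consecutiveSteps (a ∷ [])      = true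
consecutiveSteps (a ∷ b ∷ r)   = oneStep a b ∧ consecutiveSteps (b ∷ r)

startsAt : List ℕ → List (List ℕ) → Bool
startsAt s []      = false
startsAt s (a ∷ _) = a ==ℓ s

endsAt : List ℕ → List (List ℕ) → Bool
endsAt e []          = false
endsAt e (a ∷ [])    = a ==ℓ e
endsAt e (a ∷ b ∷ r) = endsAt e (b ∷ r)

isOscillating : ℕ → List ℕ → List (List ℕ) → Bool
isOscillating k μ seq =
  startsAt [] seq ∧ endsAt μ seq ∧ consecutiveSteps seq
  ∧ all (λ p → isPartition p ∧ (height p ≤ᵇ k)) seq

OscTableaux : ℕ → ℕ → ℕ → Set
OscTableaux n k m =
  Σ (Vec (List ℕ) (suc n)) λ seq → T (isOscillating k (oneRow m) (toList seq))

-- Standard Young tableaux, given as the list of their rows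
-- (English convention: row 1 on top).

strictlyIncreasing : List ℕ → Bool
strictlyIncreasing []          = true
strictlyIncreasing (x ∷ [])    = true
strictlyIncreasing (x ∷ y ∷ r) = (x <ᵇ y) ∧ strictlyIncreasing (y ∷ r)

-- each entry of the lower row is larger than the entry above it
-- (zipWith stops at the shorter, i.e. lower, row)
columnsIncrease : List (List ℕ) → Bool
columnsIncrease []          = true
columnsIncrease (r ∷ [])    = true
columnsIncrease (r ∷ s ∷ t) = and (zipWith _<ᵇ_ r s) ∧ columnsIncrease (s ∷ t)

count : ℕ → List ℕ → ℕ
count i xs = length (filter (λ x → i ≟ℕ x) xs)

entriesOneToN : ℕ → List ℕ → Bool
entriesOneToN n xs =
  (length xs ≡ᵇ n) ∧ all (λ i → count (suc i) xs ≡ᵇ 1) (upTo n)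

shape : List (List ℕ) → List ℕ
shape = map length

isSYT : ℕ → List (List ℕ) → Bool
isSYT n rows =
  isPartition (shape rows) ∧ all strictlyIncreasing rows
  ∧ columnsIncrease rows ∧ entriesOneToN n (concat rows)

-- length of the j-th column (0-indexed) of a diagram
columnLength : List ℕ → ℕ → ℕ
columnLength λ′ j = length (filter (λ x → suc j Data.Nat.≤? x) λ′)

firstRow : List ℕ → ℕ
firstRow []      = 0
firstRow (x ∷ _) = x

isOdd : ℕ → Bool
isOdd zero          = false
isOdd (suc zero)    = true
isOdd (suc (suc n)) = isOdd n

oddColumns : List ℕ → ℕ
oddColumns λ′ = length (filter (λ j → Data.Bool._≟_ (isOdd (columnLength λ′ j)) true) (upTo (firstRow λ′)))

SYTs : ℕ → ℕ → ℕ → Set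
SYTs n h m =
  Σ (List (List ℕ)) λ rows →
    T (isSYT n rows ∧ (height (shape rows) ≤ᵇ h) ∧ (oddColumns (shape rows) ≡ᵇ m))

{-# OPTIONS --safe #-}
module Submission where

-- Read an oscillating tableau step by step.  When step i adds a box, i becomes an open letter in that box;
-- when step i deletes a box, reverse bumping from it ejects an open letter a, which is row-inserted into the
-- tableau of closed letters, and i itself is put at the end of the row below the box so created (Beissinger's
-- insertion of the transposition (a i)).  Every step is reversible, and the columns of the tableau of closed
-- letters stay even.  At the end the open letters form a single row; inserting them from left to right adds
-- a horizontal strip of size m, hence makes exactly m columns odd, and by the row bumping lemma this strip
-- can be taken off again in only one way.
--
-- For the heights, extend the pairs (a i) to a fixed-point-free involution σ by closing the last m open
-- letters, in order, with m further steps.  The height of the i-th diagram is the size of the largest nest of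
-- arcs a < i ≤ σ a (steps are counted from 0).  The growth diagram of σ is symmetric, so the closed letters form the
-- insertion tableau of σ, whose height is the length of the longest decreasing subsequence.  Such a
-- subsequence crosses the diagonal, and reflecting nested arcs in the diagonal doubles them.

open import Defs
open import Data.Bool using (Bool; true; false; if_then_else_; _∧_; T)
open import Data.Bool.ListAction using (all; and)
open import Data.Bool.Properties using (T-∧; T-∨; T-irrelevant)
open import Data.Empty using (⊥; ⊥-elim)
open import Data.List using (List; []; _∷_; _++_; _∷ʳ_; length; map; concat; filter; reverse; upTo; zipWith; _ʳ++_)
open import Data.List.Membership.Propositional using (_∈_)
open import Data.List.Membership.Propositional.Properties using (∈-∃++; ∈-++⁻)
open import Data.List.Properties
  using (∷-injective; ∷ʳ-injective; ++-identityʳ; filter-++; filter-accept; filter-reject; length-++; length-map;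
         length-reverse; reverse-injective; reverse-involutive; upTo-∷ʳ; ≡-dec)
open import Data.List.Relation.Unary.All using (All; []; _∷_)
import Data.List.Relation.Unary.All as All
open import Data.List.Relation.Unary.All.Properties using (all⁺; all⁻; applyUpTo⁺₁; applyUpTo⁻; concat⁻; ++⁺; ++⁻)
open import Data.List.Relation.Unary.Any using (here; there)
open import Data.Nat
open import Data.Nat.Properties
open import Algebra.Properties.CommutativeSemigroup +-commutativeSemigroup using () renaming (x∙yz≈y∙xz to +-swap)
open import Data.Product using (Σ; ∃; _×_; _,_; proj₁; proj₂)
open import Data.Sum using (_⊎_; inj₁; inj₂)
import Data.Sum as Sum
open import Data.Unit using (⊤; tt)
open import Data.Vec using (Vec; []; _∷_; toList; fromList)
open import Data.Vec.Properties using (cast-is-id; length-toList; toList-injective; toList∘fromList)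
open import Function.Bundles using (_⤖_; mk⤖; Equivalence)
open import Relation.Binary.Definitions using (tri<; tri≈; tri>)
open import Relation.Binary.PropositionalEquality
open import Relation.Nullary using (¬_; yes; no)
open import Relation.Nullary.Decidable using (toWitness; fromWitness)

-- The factor 2 hides an off-by-one. The two ends of `k + 1` nested arcs give a decreasing
-- subsequence of `2k + 2` letters, but the tableau only sees the first `n` letters of the
-- involution, and the last `m` arcs end outside. Since the open letters are closed in order, no two
-- of these arcs are nested, so at most the outermost arc of a nest loses its right end. This leaves
-- `2k + 1` letters, one too many for `2k` rows. Conversely, the middle letter of a decreasing
-- subsequence of length `2k + 1` decides which half reflects to `k + 1` nested arcs. That the
-- number of rows is the length of a longest decreasing subsequence is Schensted's theorem. It is
-- obtained from the growth diagram: every horizontal line of the grid is turned into a word, and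
-- crossing one line preserves the lengths of increasing subsequences. Insertion and reverse
-- insertion are one relation on label sequences, so that invertibility is a symmetry and not a
-- computation.

-- Shapes as length functions; adding and removing a box

δ : ℕ → ℕ → ℕ
δ zero    zero    = 1
δ zero    (suc _) = 0
δ (suc _) zero    = 0
δ (suc i) (suc j) = δ i j

δ-refl : ∀ i → δ i i ≡ 1
δ-refl zero    = refl
δ-refl (suc i) = δ-refl i

δ-≢ : ∀ {i j} → i ≢ j → δ i j ≡ 0
δ-≢ {zero}  {zero}  p = ⊥-elim (p refl)
δ-≢ {zero}  {suc j} p = refl
δ-≢ {suc i} {zero}  p = refl
δ-≢ {suc i} {suc j} p = δ-≢ (λ e → p (cong suc e))

Antitone : (ℕ → ℕ) → Set
Antitone f = ∀ d → f (suc d) ≤ f d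

Addable : (ℕ → ℕ) → ℕ → Set
Addable f zero    = ⊤
Addable f (suc d) = f (suc d) < f d

Removable : (ℕ → ℕ) → ℕ → Set
Removable f c = f (suc c) < f c

Addable-cong : ∀ {f g} c → (∀ d → f d ≡ g d) → Addable g c → Addable f c
Addable-cong zero    e a = tt
Addable-cong (suc c) e   = subst₂ _<_ (sym (e (suc c))) (sym (e c))

Removable-cong : ∀ {f g} c → (∀ d → f d ≡ g d) → Removable g c → Removable f c
Removable-cong c e = subst₂ _<_ (sym (e (suc c))) (sym (e c))

_≗_+[_] : (ℕ → ℕ) → (ℕ → ℕ) → ℕ → Set
g ≗ f +[ c ] = ∀ d → g d ≡ δ d c + f d

+[]-at : ∀ {g f c} → g ≗ f +[ c ] → g c ≡ suc (f c)
+[]-at {f = f} {c} e = trans (e c) (cong (_+ f c) (δ-refl c))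

+[]-off : ∀ {g f c d} → g ≗ f +[ c ] → d ≢ c → g d ≡ f d
+[]-off {f = f} {d = d} e p = trans (e d) (cong (_+ f d) (δ-≢ p))

+[]-≤ : ∀ {g f c} → g ≗ f +[ c ] → ∀ d → f d ≤ g d
+[]-≤ {f = f} {c} e d = subst (f d ≤_) (sym (e d)) (m≤n+m (f d) (δ d c))

add-Antitone : ∀ {g f c} → g ≗ f +[ c ] → Antitone f → Addable f c → Antitone g
add-Antitone {g} {f} {c} e D a d with suc d ≟ c
... | yes refl = subst (_≤ g d) (sym (+[]-at {g} e)) (≤-trans a (+[]-≤ {g} e d))
... | no  p    = subst (_≤ g d) (sym (+[]-off {g} e p)) (≤-trans (D d) (+[]-≤ {g} e d))

add-Removable : ∀ {g f c} → g ≗ f +[ c ] → Antitone f → Removable g c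
add-Removable {g} {f} {c} e D =
  subst₂ _<_ (sym (+[]-off {g} e 1+n≢n)) (sym (+[]-at {g} e)) (s≤s (D c))

remove-Addable : ∀ {g f c} → g ≗ f +[ c ] → Antitone g → Addable f c
remove-Addable {c = zero}  e D = tt
remove-Addable {g} {f} {c = suc d} e D =
  subst₂ _≤_ (+[]-at {g} e) (+[]-off {g} e (λ q → 1+n≢n (sym q))) (D d)

-- A state lists the letters read so far, the latest first: op c is an open letter in column c of the
-- tableau of open letters, cl r a closed letter in row r of the tableau of closed letters.
data Label : Set where
  op cl : ℕ → Label

State : Set
State = List Label

flip : Label → Label
flip (op c) = cl c
flip (cl r) = op r

dual : State → State
dual = map flip

dual-dual : ∀ st → dual (dual st) ≡ st
dual-dual []          = refl
dual-dual (op c ∷ st) = cong (op c ∷_) (dual-dual st)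
dual-dual (cl r ∷ st) = cong (cl r ∷_) (dual-dual st)

#op : State → ℕ → ℕ
#op []          d = 0
#op (op c ∷ st) d = δ d c + #op st d
#op (cl r ∷ st) d = #op st d

#cl : State → ℕ → ℕ
#cl st = #op (dual st)

-- The letters have to form a tableau at all times (a ballot condition on every suffix).
OpLat : State → Set
OpLat []          = ⊤
OpLat (op c ∷ st) = Addable (#op st) c × OpLat st
OpLat (cl r ∷ st) = OpLat st

ClLat : State → Set
ClLat st = OpLat (dual st)

OpLat⇒Antitone : ∀ st → OpLat st → Antitone (#op st)
OpLat⇒Antitone []          _       d = z≤n
OpLat⇒Antitone (op c ∷ st) (a , L)   = add-Antitone {#op (op c ∷ st)} {#op st} {c} (λ _ → refl) (OpLat⇒Antitone st L) a
OpLat⇒Antitone (cl r ∷ st) L         = OpLat⇒Antitone st L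

-- Bump c ρ s s′: going down the list, removing the box at the foot of column c ejects an open letter by
-- reverse bumping; going back up, this letter is row-inserted among the closed ones and creates a box
-- in row ρ.
data Bump : ℕ → ℕ → State → State → Set where
  hit : ∀ {st} → Bump 0 0 (op 0 ∷ st) (cl 0 ∷ st)
  op≡ : ∀ {c ρ st st′} → Bump c ρ st st′ → Bump (suc c) ρ (op (suc c) ∷ st) (op c ∷ st′)
  op≢ : ∀ {c d ρ st st′} → d ≢ c → Bump c ρ st st′ → Bump c ρ (op d ∷ st) (op d ∷ st′)
  cl≡ : ∀ {c ρ st st′} → Bump c ρ st st′ → Bump c (suc ρ) (cl ρ ∷ st) (cl (suc ρ) ∷ st′)
  cl≢ : ∀ {c r ρ st st′} → r ≢ ρ → Bump c ρ st st′ → Bump c ρ (cl r ∷ st) (cl r ∷ st′)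

-- Ejection lowers columns on the way down the list just as insertion raises rows on the way back.
-- Open letters carry columns and closed ones rows for the sake of this symmetry: every fact about
-- ejection becomes one about insertion.
Bump-dual : ∀ {c ρ st st′} → Bump c ρ st st′ → Bump ρ c (dual st′) (dual st)
Bump-dual hit       = hit
Bump-dual (op≡ b)   = cl≡ (Bump-dual b)
Bump-dual (op≢ p b) = cl≢ p (Bump-dual b)
Bump-dual (cl≡ b)   = op≡ (Bump-dual b)
Bump-dual (cl≢ p b) = op≢ p (Bump-dual b)

Bump-dual⁻ : ∀ {c ρ st st′} → Bump ρ c (dual st′) (dual st) → Bump c ρ st st′
Bump-dual⁻ {c} {ρ} {st} {st′} b = subst₂ (Bump c ρ) (dual-dual st) (dual-dual st′) (Bump-dual b)

Bump-det : ∀ {c ρ ρ′ st s s′} → Bump c ρ st s → Bump c ρ′ st s′ → ρ ≡ ρ′ × s ≡ s′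
Bump-det hit       hit        = refl , refl
Bump-det hit       (op≢ p _)  = ⊥-elim (p refl)
Bump-det (op≡ b)   (op≡ b′)   with refl , refl ← Bump-det b b′ = refl , refl
Bump-det (op≡ b)   (op≢ p _)  = ⊥-elim (p refl)
Bump-det (op≢ p _) hit        = ⊥-elim (p refl)
Bump-det (op≢ p _) (op≡ _)    = ⊥-elim (p refl)
Bump-det (op≢ _ b) (op≢ _ b′) with refl , refl ← Bump-det b b′ = refl , refl
Bump-det (cl≡ b)   (cl≡ b′)   with refl , refl ← Bump-det b b′ = refl , refl
Bump-det (cl≡ b)   (cl≢ p b′) with refl , refl ← Bump-det b b′ = ⊥-elim (p refl)
Bump-det (cl≢ p b) (cl≡ b′)   with refl , refl ← Bump-det b b′ = ⊥-elim (p refl)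
Bump-det (cl≢ _ b) (cl≢ _ b′) with refl , refl ← Bump-det b b′ = refl , refl

dual-injective : ∀ {s s′} → dual s ≡ dual s′ → s ≡ s′
dual-injective {s} {s′} e = trans (sym (dual-dual s)) (trans (cong dual e) (dual-dual s′))

Bump-det⁻ : ∀ {c c′ ρ st s s′} → Bump c ρ s st → Bump c′ ρ s′ st → c ≡ c′ × s ≡ s′
Bump-det⁻ b b′ with Bump-det (Bump-dual b) (Bump-dual b′)
... | p , q = p , dual-injective q

Bump-length : ∀ {c ρ s s′} → Bump c ρ s s′ → length s ≡ length s′
Bump-length hit       = refl
Bump-length (op≡ b)   = cong suc (Bump-length b)
Bump-length (op≢ _ b) = cong suc (Bump-length b)
Bump-length (cl≡ b)   = cong suc (Bump-length b)
Bump-length (cl≢ _ b) = cong suc (Bump-length b)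

Bump-#op : ∀ {c ρ s s′} → Bump c ρ s s′ → #op s ≗ #op s′ +[ c ]
Bump-#op hit               d = refl
Bump-#op (op≡ {c} b)       d = cong (δ d (suc c) +_) (Bump-#op b d)
Bump-#op (op≢ {c} {e} _ b) d = trans (cong (δ d e +_) (Bump-#op b d)) (+-swap (δ d e) (δ d c) _)
Bump-#op (cl≡ b)           d = Bump-#op b d
Bump-#op (cl≢ _ b)         d = Bump-#op b d

Bump-#cl : ∀ {c ρ s s′} → Bump c ρ s s′ → #cl s′ ≗ #cl s +[ ρ ]
Bump-#cl b = Bump-#op (Bump-dual b)

-- It suffices to carry along that column `c` is nonempty: when a letter of column `suc c` is met,
-- its ballot condition says that column `c` was longer before it.
bump : ∀ c st → OpLat st → 0 < #op st c → ∃ λ ρ → ∃ λ st′ → Bump c ρ st st′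
bump c (op d ∷ st) (a , L) p with d ≟ c
bump zero    (op zero ∷ st)    (a , L) p | yes refl = 0 , cl 0 ∷ st , hit
bump (suc c) (op (suc c) ∷ st) (a , L) p | yes refl
  with ρ , st′ , b ← bump c st L (≤-trans (s≤s z≤n) a) = ρ , op c ∷ st′ , op≡ b
bump c       (op d ∷ st)       (a , L) p | no q
  with ρ , st′ , b ← bump c st L (subst (0 <_) (cong (_+ #op st c) (δ-≢ (λ e → q (sym e)))) p)
  = ρ , op d ∷ st′ , op≢ q b
bump c (cl r ∷ st) L p with bump c st L p
... | ρ , st′ , b with r ≟ ρ
...   | yes refl = suc r , cl (suc r) ∷ st′ , cl≡ b
...   | no  q    = ρ , cl r ∷ st′ , cl≢ q b

bump⁻ : ∀ ρ st′ → ClLat st′ → 0 < #cl st′ ρ → ∃ λ c → ∃ λ st → Bump c ρ st st′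
bump⁻ ρ st′ L p with c , s , b ← bump ρ (dual st′) L p =
  c , dual s , Bump-dual⁻ (subst (Bump ρ c (dual st′)) (sym (dual-dual s)) b)

-- Bumping and the ballot condition

private
  pass-Removable : ∀ {F d c} → d ≢ c → Removable (λ i → δ i d + F i) c → Removable F c
  pass-Removable {F} {d} {c} p r =
    ≤-trans (s≤s (m≤n+m (F (suc c)) (δ (suc c) d)))
            (subst (δ (suc c) d + F (suc c) <_) (cong (_+ F c) (δ-≢ (λ e → p (sym e)))) r)

  pass-Addable : ∀ {F F′ d c} → d ≢ c → F ≗ F′ +[ c ] → Addable F d →
                 Removable (λ i → δ i d + F i) c → Addable F′ d
  pass-Addable {d = zero} p e a r = tt
  pass-Addable {F} {F′} {d = suc d} {c} p e a r with d ≟ c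
  ... | no  q    = subst (F′ (suc d) <_) (+[]-off {F} e q) (≤-<-trans (+[]-≤ {F} e (suc d)) a)
  ... | yes refl = ≤-pred (subst₂ _<_ (trans (cong (_+ F (suc d)) (δ-refl d)) (cong suc (+[]-off {F} e 1+n≢n)))
                     (trans (cong (_+ F d) (δ-≢ {d} {suc d} (λ q → 1+n≢n (sym q)))) (+[]-at {F} e)) r)

-- Removability is handed down the list: the ballot condition of a letter in column `suc c` is
-- literally removability of column `c` below it, where the bump continues.
Bump-OpLat : ∀ {c ρ s s′} → Bump c ρ s s′ → OpLat s → Removable (#op s) c → OpLat s′
Bump-OpLat hit (_ , L) r = L
Bump-OpLat (op≡ {zero} {st = st} b) (a , L) r = tt , Bump-OpLat b L a
Bump-OpLat (op≡ {suc d} {st = st} b) (a , L) r =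
  subst₂ _≤_ (+[]-at {#op st} (Bump-#op b)) (+[]-off {#op st} (Bump-#op b) (λ q → 1+n≢n (sym q)))
    (OpLat⇒Antitone st L d) ,
  Bump-OpLat b L a
Bump-OpLat (op≢ {c} {d} {st = st} p b) (a , L) r =
  pass-Addable {#op st} {d = d} p (Bump-#op b) a r ,
  Bump-OpLat b L (pass-Removable {#op st} {d = d} p r)
Bump-OpLat (cl≡ b)   L r = Bump-OpLat b L r
Bump-OpLat (cl≢ _ b) L r = Bump-OpLat b L r

-- Read through `Bump-dual`: row insertion into a tableau gives a tableau, and the new box is a
-- corner. The corner is part of the conclusion because in `op≡` it becomes the ballot condition of
-- the letter that returns to column `suc c`.
Bump-OpLat⁻ : ∀ {c ρ s s′} → Bump c ρ s s′ → OpLat s′ → OpLat s × Removable (#op s) c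
Bump-OpLat⁻ (hit {st}) L = (tt , L) , s≤s (OpLat⇒Antitone st L 0)
Bump-OpLat⁻ (op≡ {c} {st = st} b) (_ , L) with Bump-OpLat⁻ b L
... | L′ , r = (r , L′) , add-Removable {#op (op (suc c) ∷ st)} {#op st} {suc c} (λ _ → refl) (OpLat⇒Antitone st L′)
Bump-OpLat⁻ (op≢ {c} {d} {st = st} {st′} p b) (a , L) with Bump-OpLat⁻ b L
... | L′ , r = (a′ d p a , L′) , r′
  where
  e = Bump-#op b
  a′ : ∀ d → d ≢ c → Addable (#op st′) d → Addable (#op st) d
  a′ zero    p a = tt
  a′ (suc d) p a = subst (_< #op st d) (sym (+[]-off {#op st} e p)) (≤-trans a (+[]-≤ {#op st} e d))
  r′ : Removable (#op (op d ∷ st)) c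
  r′ with suc c ≟ d
  ... | no  q    = subst₂ _<_ (cong (_+ #op st (suc c)) (sym (δ-≢ q)))
                     (cong (_+ #op st c) (sym (δ-≢ (λ x → p (sym x))))) r
  ... | yes refl = subst₂ _<_ (cong₂ _+_ (sym (δ-refl c)) (sym (+[]-off {#op st} e 1+n≢n)))
                     (trans (sym (+[]-at {#op st} e)) (cong (_+ #op st c) (sym (δ-≢ (λ x → p (sym x))))))
                     (s≤s a)
Bump-OpLat⁻ (cl≡ b)   L = Bump-OpLat⁻ b L
Bump-OpLat⁻ (cl≢ _ b) L = Bump-OpLat⁻ b L

Bump-ClLat : ∀ {c ρ s s′} → Bump c ρ s s′ → ClLat s → ClLat s′ × Removable (#cl s′) ρ
Bump-ClLat b = Bump-OpLat⁻ (Bump-dual b)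

Bump-ClLat⁻ : ∀ {c ρ s s′} → Bump c ρ s s′ → ClLat s′ → Removable (#cl s′) ρ → ClLat s
Bump-ClLat⁻ b = Bump-OpLat (Bump-dual b)

-- The row bumping lemma, in a form symmetric under `dual`. A letter moved by both bumps fixes the
-- alternative, since its column drops, or its row grows, by one each time; a letter moved by only
-- one of them turns a weak inequality into a strict one or the reverse.
row-bumping : ∀ {c₁ c₂ ρ₁ ρ₂ s₀ s₁ s₂} → Bump c₁ ρ₁ s₀ s₁ → Bump c₂ ρ₂ s₁ s₂ →
            (c₂ < c₁ × ρ₂ ≤ ρ₁) ⊎ (c₁ ≤ c₂ × ρ₁ < ρ₂)
row-bumping hit       (cl≡ _)   = inj₂ (z≤n , s≤s z≤n)
row-bumping hit       (cl≢ p _) = inj₂ (z≤n , n≢0⇒n>0 (λ e → p (sym e)))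
row-bumping (op≡ _)   hit       = inj₁ (s≤s z≤n , z≤n)
row-bumping (op≢ p _) hit       = inj₁ (n≢0⇒n>0 (λ e → p (sym e)) , z≤n)
row-bumping (op≡ a)   (op≡ b)   with row-bumping a b
... | inj₁ (p , q) = inj₁ (≤-refl , q)
... | inj₂ (p , q) = ⊥-elim (1+n≰n p)
row-bumping (op≡ a)   (op≢ x b) with row-bumping a b
... | inj₁ (p , q) = inj₁ (m≤n⇒m≤1+n p , q)
... | inj₂ (p , q) = inj₂ (≤∧≢⇒< p x , q)
row-bumping (op≢ x a) (op≡ b)   with row-bumping a b
... | inj₁ (p , q) = inj₁ (≤∧≢⇒< p x , q)
... | inj₂ (p , q) = inj₂ (m≤n⇒m≤1+n p , q)
row-bumping (op≢ x a) (op≢ y b) = row-bumping a b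
row-bumping (cl≡ a)   (cl≡ b)   with row-bumping a b
... | inj₁ (p , q) = ⊥-elim (1+n≰n q)
... | inj₂ (p , q) = inj₂ (p , ≤-refl)
row-bumping (cl≡ a)   (cl≢ x b) with row-bumping a b
... | inj₁ (p , q) = inj₁ (p , m≤n⇒m≤1+n q)
... | inj₂ (p , q) = inj₂ (p , ≤∧≢⇒< q x)
row-bumping (cl≢ x a) (cl≡ b)   with row-bumping a b
... | inj₁ (p , q) = inj₁ (p , ≤∧≢⇒< q x)
... | inj₂ (p , q) = inj₂ (p , m≤n⇒m≤1+n q)
row-bumping (cl≢ x a) (cl≢ y b) = row-bumping a b

-- Even columns: rows in pairs of equal length

dbl : ℕ → ℕ
dbl zero    = zero
dbl (suc j) = suc (suc (dbl j))

even-or-odd : ∀ r → (∃ λ j → r ≡ dbl j) ⊎ (∃ λ j → r ≡ suc (dbl j))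
even-or-odd zero = inj₁ (0 , refl)
even-or-odd (suc r) with even-or-odd r
... | inj₁ (j , refl) = inj₂ (j , refl)
... | inj₂ (j , refl) = inj₁ (suc j , refl)

dbl-mono-≤ : ∀ {i j} → i ≤ j → dbl i ≤ dbl j
dbl-mono-≤ z≤n     = z≤n
dbl-mono-≤ (s≤s p) = s≤s (s≤s (dbl-mono-≤ p))

dbl-cancel-< : ∀ {i j} → dbl i < dbl j → i < j
dbl-cancel-< {i} {j} p with i <? j
... | yes q = q
... | no  q = ⊥-elim (<⇒≱ p (dbl-mono-≤ (≮⇒≥ q)))

δ-dbl : ∀ i j → δ (dbl i) (dbl j) ≡ δ i j
δ-dbl zero    zero    = refl
δ-dbl zero    (suc j) = refl
δ-dbl (suc i) zero    = refl
δ-dbl (suc i) (suc j) = δ-dbl i j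

δ-even-odd : ∀ i j → δ (dbl i) (suc (dbl j)) ≡ 0
δ-even-odd zero    j       = refl
δ-even-odd (suc i) zero    = refl
δ-even-odd (suc i) (suc j) = δ-even-odd i j

δ-odd-even : ∀ i j → δ (suc (dbl i)) (dbl j) ≡ 0
δ-odd-even i       zero    = refl
δ-odd-even zero    (suc j) = refl
δ-odd-even (suc i) (suc j) = δ-odd-even i j

-- Rows are counted from 0. In a diagram all columns are even exactly when rows `dbl j` and
-- `suc (dbl j)` have equal length for all `j`.
PairedAt : (ℕ → ℕ) → ℕ → Set
PairedAt f j = f (dbl j) ≡ f (suc (dbl j))

Paired : (ℕ → ℕ) → Set
Paired f = ∀ j → PairedAt f j

record Good (s : State) : Set where
  constructor good
  field
    opLat  : OpLat s
    clLat  : ClLat s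
    paired : Paired (#cl s)
open Good

-- The lower row of an equal pair cannot grow. Only the pairs above `ρ` are asked to be equal, so
-- that this also serves while a horizontal strip is being added.
Addable-even : ∀ {f ρ} → Addable f ρ → (∀ j → dbl j < ρ → PairedAt f j) → ∃ λ i → ρ ≡ dbl i
Addable-even {f} {ρ} a P with even-or-odd ρ
... | inj₁ e          = e
... | inj₂ (j , refl) = ⊥-elim (<⇒≢ a (sym (P j ≤-refl)))

private
  closed-even : ∀ {f f′ i} → f′ ≗ f +[ dbl i ] → ∀ j →
                δ (dbl j) (suc (dbl i)) + f′ (dbl j) ≡ δ j i + f (dbl j)
  closed-even {f} {f′} {i} e j =
    trans (cong₂ _+_ (δ-even-odd j i) (e (dbl j))) (cong (_+ f (dbl j)) (δ-dbl j i))

  closed-odd : ∀ {f f′ i} → f′ ≗ f +[ dbl i ] → ∀ j →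
               δ (dbl j) (dbl i) + f′ (suc (dbl j)) ≡ δ j i + f (suc (dbl j))
  closed-odd {f} {f′} {i} e j =
    cong₂ _+_ (δ-dbl j i) (trans (e (suc (dbl j))) (cong (_+ f (suc (dbl j))) (δ-odd-even j i)))

Good-up : ∀ {c s} → Good s → Addable (#op s) c → Good (op c ∷ s)
Good-up (good o l p) a = good (a , o) l p

-- The insertion makes the upper row `ρ` of some pair longer by one; the letter of the step itself,
-- put into row `suc ρ`, restores the pair.
Good-down : ∀ {c ρ s s′} → Good s → Removable (#op s) c → Bump c ρ s s′ → Good (cl (suc ρ) ∷ s′)
Good-down {c} {ρ} {s} {s′} (good o l p) r b =
  good (Bump-OpLat b o r) (proj₂ cl′ , proj₁ cl′) pr
  where
  cl′ = Bump-ClLat b l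
  ev  = Addable-even {#cl s} (remove-Addable {#cl s′} (Bump-#cl b) (OpLat⇒Antitone (dual s′) (proj₁ cl′))) (λ j _ → p j)
  pr : Paired (#cl (cl (suc ρ) ∷ s′))
  pr j with i , refl ← ev =
    trans (closed-even {#cl s} (Bump-#cl b) j)
      (trans (cong (δ j i +_) (p j)) (sym (closed-odd {#cl s} (Bump-#cl b) j)))

Good-up⁻ : ∀ {c s} → Good (op c ∷ s) → Good s × Addable (#op s) c
Good-up⁻ (good (a , o) l p) = good o l p , a

-- Dropping the last letter from an upper row would leave it shorter than the row below, so `e` is
-- odd. Once it is dropped from the lower row, the upper one ends in a corner, and reverse insertion
-- starts there.
Good-down⁻ : ∀ {e s′} → Good (cl e ∷ s′) →
             ∃ λ c → ∃ λ ρ → ∃ λ s → e ≡ suc ρ × Bump c ρ s s′ × Good s × Removable (#op s) c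
Good-down⁻ {e} {s′} (good o (a , l) p) with even-or-odd e
... | inj₁ (i , refl) = ⊥-elim (<⇒≱ (≤-reflexive eq) (OpLat⇒Antitone (dual s′) l (dbl i)))
  where
  f = #cl s′
  eq : suc (f (dbl i)) ≡ f (suc (dbl i))
  eq = trans (cong (_+ f (dbl i)) (sym (δ-refl (dbl i)))) (trans (p i)
         (cong (_+ f (suc (dbl i))) (δ-odd-even i i)))
... | inj₂ (i , refl) =
  let c , s , b = bump⁻ (dbl i) s′ l (≤-trans (s≤s z≤n) rem)
      o′ , r    = Bump-OpLat⁻ b o
  in c , dbl i , s , refl , b , good o′ (Bump-ClLat⁻ b l rem) (pr s b) , r
  where
  f = #cl s′
  rem : Removable f (dbl i)
  rem = ≤-reflexive (trans (cong (_+ f (suc (dbl i))) (sym (δ-refl (dbl i)))) (trans (sym (p i))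
          (cong (_+ f (dbl i)) (δ-even-odd i i))))
  pr : ∀ {c} s → Bump c (dbl i) s s′ → Paired (#cl s)
  pr s b j = +-cancelˡ-≡ (δ j i) _ _ (trans (sym (closed-even {#cl s} (Bump-#cl b) j))
               (trans (p j) (closed-odd {#cl s} (Bump-#cl b) j)))

-- Odd columns: the horizontal strip of the last open letters

-- The column lengths of the one-row shape of size `m`.
ind : ℕ → ℕ → ℕ
ind zero    d       = 0
ind (suc m) zero    = 1
ind (suc m) (suc d) = ind m d

ind-suc : ∀ m d → ind (suc m) d ≡ δ d m + ind m d
ind-suc zero    zero    = refl
ind-suc zero    (suc d) = refl
ind-suc (suc m) zero    = refl
ind-suc (suc m) (suc d) = ind-suc m d

ind-Addable : ∀ m c → Addable (ind m) c → c ≤ m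
ind-Addable m       zero          a = z≤n
ind-Addable (suc m) (suc zero)    a = s≤s z≤n
ind-Addable (suc m) (suc (suc c)) a = s≤s (ind-Addable m (suc c) a)

ind-Removable : ∀ m → Removable (ind (suc m)) m
ind-Removable zero    = s≤s z≤n
ind-Removable (suc m) = ind-Removable m

-- For the row lengths f of a diagram with at most 2J rows, the number of columns of odd length.
alt : ℕ → (ℕ → ℕ) → ℕ
alt zero    f = 0
alt (suc J) f = (f (dbl J) ∸ f (suc (dbl J))) + alt J f

alt-cong : ∀ J {f g} → (∀ j → j < J → f (dbl j) ≡ g (dbl j) × f (suc (dbl j)) ≡ g (suc (dbl j))) →
           alt J f ≡ alt J g
alt-cong zero    e = refl
alt-cong (suc J) e =
  cong₂ _+_ (cong₂ _∸_ (proj₁ (e J ≤-refl)) (proj₂ (e J ≤-refl))) (alt-cong J (λ j p → e j (m<n⇒m<1+n p)))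

alt-add : ∀ J {f g i} → i < J → Antitone f → g ≗ f +[ dbl i ] → alt J g ≡ suc (alt J f)
alt-add (suc J) {f} {g} {i} p D e with i ≟ J
... | yes refl = cong₂ _+_
    (trans (cong₂ _∸_ (+[]-at {g} e) (+[]-off {g} e 1+n≢n)) (+-∸-assoc 1 (D (dbl i))))
    (alt-cong J (λ j q → same j (<⇒≢ q)))
  where
  same : ∀ j → j ≢ i → g (dbl j) ≡ f (dbl j) × g (suc (dbl j)) ≡ f (suc (dbl j))
  same j q = trans (e (dbl j)) (cong (_+ f (dbl j)) (trans (δ-dbl j i) (δ-≢ q))) ,
             trans (e (suc (dbl j))) (cong (_+ f (suc (dbl j))) (δ-odd-even j i))
... | no  q    = trans (cong₂ _+_ (cong₂ _∸_
      (trans (e (dbl J)) (cong (_+ f (dbl J)) (trans (δ-dbl J i) (δ-≢ (λ x → q (sym x))))))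
      (trans (e (suc (dbl J))) (cong (_+ f (suc (dbl J))) (δ-odd-even J i))))
    (alt-add J (≤∧≢⇒< (≤-pred p) q) D e)) (+-suc _ _)

Bounded : ℕ → (ℕ → ℕ) → Set
Bounded J f = ∀ d → dbl J ≤ d → f d ≡ 0

Bounded-> : ∀ {J f i} → Bounded J f → 0 < f (dbl i) → i < J
Bounded-> {J} {f} {i} B p with i <? J
... | yes q = q
... | no  q = ⊥-elim (<⇒≢ p (sym (B (dbl i) (dbl-mono-≤ (≮⇒≥ q)))))

-- For a diagram with row lengths `f`: the rightmost column of odd length ends in row `dbl i`.
LeastGap : ℕ → (ℕ → ℕ) → Set
LeastGap i f = Removable f (dbl i) × (∀ j → j < i → PairedAt f j)

LeastGap-unique : ∀ {i j f} → LeastGap i f → LeastGap j f → i ≡ j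
LeastGap-unique {i} {j} {f} (r , p) (r′ , p′) with <-cmp i j
... | tri< q _ _ = ⊥-elim (<⇒≢ r (sym (p′ i q)))
... | tri≈ _ q _ = q
... | tri> _ _ q = ⊥-elim (<⇒≢ r′ (sym (p j q)))

gap-search : ∀ J f → Antitone f → (∃ λ i → LeastGap i f) ⊎ (alt J f ≡ 0 × ∀ j → j < J → PairedAt f j)
gap-search zero    f D = inj₂ (refl , λ _ ())
gap-search (suc J) f D with gap-search J f D
... | inj₁ x = inj₁ x
... | inj₂ (a , p) with f (dbl J) ≟ f (suc (dbl J))
...   | no  q = inj₁ (J , ≤∧≢⇒< (D (dbl J)) (λ e → q (sym e)) , p)
...   | yes q = inj₂ (cong₂ _+_ (trans (cong (_∸ f (suc (dbl J))) q) (n∸n≡0 (f (suc (dbl J))))) a , p′)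
  where
  p′ : ∀ j → j < suc J → PairedAt f j
  p′ j r with j ≟ J
  ... | yes refl = q
  ... | no  n    = p j (≤∧≢⇒< (≤-pred r) n)

alt≡0⇒Paired : ∀ J {f} → Antitone f → Bounded J f → alt J f ≡ 0 → Paired f
alt≡0⇒Paired J {f} D B e j with j <? J
... | no  q = trans (B _ le) (sym (B _ (m≤n⇒m≤1+n le)))
  where le = dbl-mono-≤ (≮⇒≥ q)
... | yes q = go J e q
  where
  go : ∀ J → alt J f ≡ 0 → j < J → PairedAt f j
  go (suc J) e q with j ≟ J
  ... | yes refl = ≤-antisym (m∸n≡0⇒m≤n (m+n≡0⇒m≡0 _ e)) (D (dbl j))
  ... | no  n    = go J (m+n≡0⇒n≡0 (f (dbl J) ∸ f (suc (dbl J))) e) (≤∧≢⇒< (≤-pred q) n)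

Paired⇒alt≡0 : ∀ J {f} → Paired f → alt J f ≡ 0
Paired⇒alt≡0 zero    p = refl
Paired⇒alt≡0 (suc J) {f} p =
  cong₂ _+_ (trans (cong (_∸ f (suc (dbl J))) (p J)) (n∸n≡0 (f (suc (dbl J))))) (Paired⇒alt≡0 J p)

infixr 5 _∷⟨_⟩_

-- The m open letters left at the end are inserted from left to right, which adds a horizontal strip.
data Flush : ℕ → State → State → Set where
  done   : ∀ {s} → Flush 0 s s
  _∷⟨_⟩_ : ∀ {m i s s′ q} → Bump m (dbl i) s s′ → LeastGap i (#cl s′) → Flush m s′ q → Flush (suc m) s q

Flush-det : ∀ {m s q q′} → Flush m s q → Flush m s q′ → q ≡ q′
Flush-det done           done             = refl
Flush-det (b ∷⟨ _ ⟩ fl) (b′ ∷⟨ _ ⟩ fl′) with Bump-det b b′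
... | _ , refl = Flush-det fl fl′

-- Each box was created at the foot of what was then the rightmost odd column. The tableau has only
-- one such place, so the row to reverse from is forced.
Flush-det⁻ : ∀ {m s s′ q} → Flush m s q → Flush m s′ q → s ≡ s′
Flush-det⁻ done done = refl
Flush-det⁻ (_∷⟨_⟩_ {s′ = t} b g fl) (b′ ∷⟨ g′ ⟩ fl′) with Flush-det⁻ fl fl′
... | refl with LeastGap-unique {f = #cl t} g g′
...   | refl = proj₂ (Bump-det⁻ b b′)

Flush-length : ∀ {m s q} → Flush m s q → length s ≡ length q
Flush-length done          = refl
Flush-length (b ∷⟨ _ ⟩ fl) = trans (Bump-length b) (Flush-length fl)

Flush-#cl : ∀ {m s q} → Flush m s q → ∀ d → #cl s d ≤ #cl q d
Flush-#cl done d = ≤-refl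
Flush-#cl (_∷⟨_⟩_ {s = s} {s′ = s′} b _ fl) d = ≤-trans (+[]-≤ {#cl s′} (Bump-#cl b) d) (Flush-#cl fl d)

private
  ind-pred : ∀ {m c ρ s s′} → Bump c ρ s s′ → m ≡ c → (∀ d → #op s d ≡ ind (suc m) d) → ∀ d → #op s′ d ≡ ind m d
  ind-pred {m} b refl e d =
    +-cancelˡ-≡ (δ d m) _ _ (trans (sym (Bump-#op b d)) (trans (e d) (ind-suc m d)))

dbl-mono-< : ∀ {i j} → i < j → dbl i < dbl j
dbl-mono-< p = ≤-trans (n≤1+n _) (dbl-mono-≤ p)

odd≢even : ∀ i j → suc (dbl i) ≢ dbl j
odd≢even (suc i) (suc j) e = odd≢even i j (suc-injective (suc-injective e))

add-PairedAt : ∀ {f g i j} → g ≗ f +[ dbl i ] → j ≢ i → PairedAt f j → PairedAt g j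
add-PairedAt {f} {g} {i} {j} e n p = trans (+[]-off {g} e (λ x → n (dbl-injective j i x)))
    (trans p (sym (+[]-off {g} e (odd≢even j i))))
  where
  dbl-injective : ∀ i j → dbl i ≡ dbl j → i ≡ j
  dbl-injective zero    zero    e = refl
  dbl-injective (suc i) (suc j) e = cong suc (dbl-injective i j (suc-injective (suc-injective e)))

-- The last hypothesis keeps the pairs above the next box equal, which forces that box into an even
-- row. It survives a step because, by `row-bumping`, the following box lies no lower.
flush′ : ∀ m s → OpLat s → (∀ d → #op s d ≡ ind m d) → ClLat s →
         (∀ {c ρ s′} → Bump c ρ s s′ → suc c ≡ m → ∀ j → dbl j < ρ → PairedAt (#cl s) j) →
         ∃ λ q → Flush m s q × (∀ d → #op q d ≡ 0) × ClLat q ×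
                 (∀ J → Bounded J (#cl q) → alt J (#cl q) ≡ m + alt J (#cl s))
flush′ zero    s o e l h = s , done , e , l , λ _ _ → refl
flush′ (suc m) s o e l h
  -- Emptying the last column moves every open letter one column to the left and ejects the leftmost
  -- one.
  with ρ , s′ , b ← bump m s o (≤-trans (s≤s z≤n) (Removable-cong m e (ind-Removable m)))
  with l′ , r′ ← Bump-ClLat b l
  with i , refl ← Addable-even {#cl s} (remove-Addable {#cl s′} (Bump-#cl b) (OpLat⇒Antitone (dual s′) l′)) (h b refl)
  = let q , fl , z , lq , a = flush′ m s′ (Bump-OpLat b o (Removable-cong m e (ind-Removable m)))
                                (ind-pred b refl e) l′ h′
    in q , b ∷⟨ r′ , pres ⟩ fl , z , lq , a′ q fl a
  where
  pres : ∀ j → j < i → PairedAt (#cl s′) j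
  pres j p = add-PairedAt {#cl s} (Bump-#cl b) (<⇒≢ p) (h b refl j (dbl-mono-< p))
  h′ : ∀ {c ρ s″} → Bump c ρ s′ s″ → suc c ≡ m → ∀ j → dbl j < ρ → PairedAt (#cl s′) j
  h′ b′ refl j p with row-bumping b b′
  ... | inj₁ (_ , q) = pres j (dbl-cancel-< (<-≤-trans p q))
  ... | inj₂ (q , _) = ⊥-elim (1+n≰n q)
  a′ : ∀ q → Flush m s′ q → (∀ J → Bounded J (#cl q) → alt J (#cl q) ≡ m + alt J (#cl s′)) →
       ∀ J → Bounded J (#cl q) → alt J (#cl q) ≡ suc m + alt J (#cl s)
  a′ q fl a J B = trans (a J B) (trans (cong (m +_) (alt-add J i<J (OpLat⇒Antitone (dual s) l) (Bump-#cl b))) (+-suc m _))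
    where
    i<J : i < J
    i<J = Bounded-> {J} {#cl q} B (≤-trans (≤-trans (s≤s z≤n) r′) (Flush-#cl fl (dbl i)))

flush : ∀ m s → Good s → (∀ d → #op s d ≡ ind m d) →
        ∃ λ q → Flush m s q × (∀ d → #op q d ≡ 0) × ClLat q × (∀ J → Bounded J (#cl q) → alt J (#cl q) ≡ m)
flush m s (good o l p) e with q , fl , z , lq , a ← flush′ m s o e l (λ _ _ j _ → p j) =
  q , fl , z , lq , λ J B → trans (a J B) (trans (cong (m +_) (Paired⇒alt≡0 J p)) (+-identityʳ m))

-- Boxes are taken off the odd columns from right to left.
unflush′ : ∀ k j J s q → Flush j s q → Bounded J (#cl s) → alt J (#cl s) ≡ k →
           OpLat s → (∀ d → #op s d ≡ ind j d) → ClLat s →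
           (∀ {c i s′} → Bump c (dbl i) s′ s → LeastGap i (#cl s) → j ≤ c) →
           ∃ λ t → Flush (k + j) t q × Good t × (∀ d → #op t d ≡ ind (k + j) d)
unflush′ k j J s q fl B a o e l h with gap-search J (#cl s) (OpLat⇒Antitone (dual s) l)
unflush′ zero j J s q fl B a o e l h | inj₂ _ =
  s , fl , good o l (alt≡0⇒Paired J (OpLat⇒Antitone (dual s) l) B a) , e
unflush′ zero j J s q fl B a o e l h | inj₁ (i , g , _) =
  ⊥-elim (<⇒≢ g (sym (alt≡0⇒Paired J (OpLat⇒Antitone (dual s) l) B a i)))
unflush′ (suc k) j J s q fl B a o e l h | inj₂ (z , _) with () ← trans (sym a) z
unflush′ (suc k) j J s q fl B a o e l h | inj₁ (i , g) with bump⁻ (dbl i) s l (≤-trans (s≤s z≤n) (proj₁ g))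
... | c , s′ , b with Bump-OpLat⁻ b o
-- The open letter returns in column `j`: not further left by the row bumping hypothesis `h`, not
-- further right because a row of `j` boxes has no other place for it.
...   | o′ , r with ≤-antisym (h b g) (ind-Addable j c (Addable-cong c (λ d → sym (e d))
                   (remove-Addable {#op s′} (Bump-#op b) (OpLat⇒Antitone s′ o′))))
...     | refl = subst (λ n → ∃ λ t → Flush n t q × Good t × (∀ d → #op t d ≡ ind n d)) (+-suc k j)
    (unflush′ k (suc j) J s′ q (b ∷⟨ g ⟩ fl) B′ a′ o′ e′ l′ h′)
  where
  l′ = Bump-ClLat⁻ b l (proj₁ g)
  B′ : Bounded J (#cl s′)
  B′ d p = n≤0⇒n≡0 (subst (#cl s′ d ≤_) (B d p) (+[]-≤ {#cl s} (Bump-#cl b) d))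
  a′ : alt J (#cl s′) ≡ k
  a′ = suc-injective (trans (sym (alt-add J (Bounded-> {J} {#cl s} B (≤-trans (s≤s z≤n) (proj₁ g)))
         (OpLat⇒Antitone (dual s′) l′) (Bump-#cl b))) a)
  e′ : ∀ d → #op s′ d ≡ ind (suc j) d
  e′ d = trans (Bump-#op b d) (trans (cong (δ d j +_) (e d)) (sym (ind-suc j d)))
  h′ : ∀ {c i′ s″} → Bump c (dbl i′) s″ s′ → LeastGap i′ (#cl s′) → suc j ≤ c
  h′ {i′ = i′} b′ (r′ , _) with row-bumping b′ b
  ... | inj₁ (p , _) = p
  ... | inj₂ (_ , p) = ⊥-elim (<⇒≢ r′ (sym (remove-PairedAt (proj₂ g i′ (dbl-cancel-< p)))))
    where
    remove-PairedAt : PairedAt (#cl s) i′ → PairedAt (#cl s′) i′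
    remove-PairedAt x = trans (sym (+[]-off {#cl s} (Bump-#cl b) (<⇒≢ p)))
                          (trans x (+[]-off {#cl s} (Bump-#cl b) (odd≢even i′ i)))

unflush : ∀ m J q → Bounded J (#cl q) → alt J (#cl q) ≡ m → (∀ d → #op q d ≡ 0) → OpLat q → ClLat q →
          ∃ λ t → Flush m t q × Good t × (∀ d → #op t d ≡ ind m d)
unflush m J q B a z o l =
  subst (λ n → ∃ λ t → Flush n t q × Good t × (∀ d → #op t d ≡ ind n d)) (+-identityʳ m)
    (unflush′ m 0 J q q done B a o z l (λ _ _ → z≤n))

T∧⁻ : ∀ {a b} → T (a ∧ b) → T a × T b
T∧⁻ = Equivalence.to T-∧

T∧ : ∀ {a b} → T a → T b → T (a ∧ b)
T∧ p q = Equivalence.from T-∧ (p , q)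

-- Partitions and oscillating tableaux

data Desc (b : ℕ) : List ℕ → Set where
  []        : Desc b []
  cons      : ∀ {x xs} → 1 ≤ x → x ≤ b → Desc x xs → Desc b (x ∷ xs)

Desc-weaken : ∀ {b b′ xs} → b ≤ b′ → Desc b xs → Desc b′ xs
Desc-weaken p []           = []
Desc-weaken p (cons q r d) = cons q (≤-trans r p) d

Part : List ℕ → Set
Part xs = ∃ λ b → Desc b xs

Part⇒T : ∀ {xs} → Part xs → T (isPartition xs)
Part⇒T (b , d) = T∧ (pos d) (dec d)
  where
  pos : ∀ {b xs} → Desc b xs → T (all (λ x → 1 ≤ᵇ x) xs)
  pos []           = tt
  pos (cons p _ d) = T∧ (≤⇒≤ᵇ p) (pos d)
  dec : ∀ {b xs} → Desc b xs → T (weaklyDecreasing xs)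
  dec []                          = tt
  dec (cons _ _ [])               = tt
  dec (cons _ _ d@(cons _ q _))   = T∧ (≤⇒≤ᵇ q) (dec d)

T⇒Part : ∀ {xs} → T (isPartition xs) → Part xs
T⇒Part {[]}     t = 0 , []
T⇒Part {x ∷ xs} t with p , w ← T∧⁻ {all (λ x → 1 ≤ᵇ x) (x ∷ xs)} t = x , go x xs p w
  where
  go : ∀ x xs → T (all (λ x → 1 ≤ᵇ x) (x ∷ xs)) → T (weaklyDecreasing (x ∷ xs)) → Desc x (x ∷ xs)
  go x []       p w = cons (≤ᵇ⇒≤ 1 x (proj₁ (T∧⁻ {1 ≤ᵇ x} p))) ≤-refl []
  go x (y ∷ xs) p w with p₁ , p₂ ← T∧⁻ {1 ≤ᵇ x} p | w₁ , w₂ ← T∧⁻ {y ≤ᵇ x} w =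
    cons (≤ᵇ⇒≤ 1 x p₁) ≤-refl (Desc-weaken (≤ᵇ⇒≤ y x w₁) (go y xs p₂ w₂))

col : List ℕ → ℕ → ℕ
col = columnLength

col-∷-> : ∀ {x xs c} → c < x → col (x ∷ xs) c ≡ suc (col xs c)
col-∷-> {x} {xs} {c} p = cong length (filter-accept (suc c ≤?_) {x} {xs} p)

col-∷-≤ : ∀ {x xs c} → x ≤ c → col (x ∷ xs) c ≡ col xs c
col-∷-≤ {x} {xs} {c} p = cong length (filter-reject (suc c ≤?_) {x} {xs} (≤⇒≯ p))

col-beyond : ∀ {b xs c} → Desc b xs → b ≤ c → col xs c ≡ 0
col-beyond []                      q = refl
col-beyond (cons {x} {xs} _ p d) q = trans (col-∷-≤ {x} {xs} (≤-trans p q)) (col-beyond d (≤-trans p q))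

col-0 : ∀ {b xs} → Desc b xs → col xs 0 ≡ length xs
col-0 []                     = refl
col-0 (cons {x} {xs} p _ d) = trans (col-∷-> {x} {xs} p) (cong suc (col-0 d))

col-injective : ∀ {b b′ xs ys} → Desc b xs → Desc b′ ys → (∀ c → col xs c ≡ col ys c) → xs ≡ ys
col-injective [] [] e = refl
col-injective [] (cons {x} {xs} p _ _) e with () ← trans (e 0) (col-∷-> {x} {xs} p)
col-injective (cons {x} {xs} p _ _) [] e with () ← trans (sym (e 0)) (col-∷-> {x} {xs} p)
col-injective (cons {x} {xs} p _ d) (cons {y} {ys} p′ _ d′) e with <-cmp x y
... | tri< q _ _ with () ← trans (sym (col-beyond (cons p ≤-refl d) ≤-refl)) (trans (e x) (col-∷-> {y} {ys} q))
... | tri> _ _ q with () ← trans (sym (col-beyond (cons p′ ≤-refl d′) ≤-refl)) (trans (sym (e y)) (col-∷-> {x} {xs} q))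
... | tri≈ _ refl _ = cong (x ∷_) (col-injective d d′ e′)
  where
  e′ : ∀ c → col xs c ≡ col ys c
  e′ c with c <? x
  ... | yes q = suc-injective (trans (sym (col-∷-> {x} {xs} q)) (trans (e c) (col-∷-> {x} {ys} q)))
  ... | no  q = trans (sym (col-∷-≤ {x} {xs} (≮⇒≥ q))) (trans (e c) (col-∷-≤ {x} {ys} (≮⇒≥ q)))

data Add : ℕ → List ℕ → List ℕ → Set where
  new   : Add 0 [] (1 ∷ [])
  here  : ∀ {x xs} → Add x (x ∷ xs) (suc x ∷ xs)
  there : ∀ {c x xs ys} → Add c xs ys → Add c (x ∷ xs) (x ∷ ys)

Add-det : ∀ {c c′ xs ys} → Add c xs ys → Add c′ xs ys → c ≡ c′
Add-det new       new        = refl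
Add-det here      here       = refl
Add-det (there a) (there a′) = Add-det a a′

Add-asym : ∀ {c c′ xs ys} → Add c xs ys → Add c′ ys xs → ⊥
Add-asym (there a) (there a′) = Add-asym a a′

Add-col : ∀ {c xs ys} → Add c xs ys → col ys ≗ col xs +[ c ]
Add-col new zero    = refl
Add-col new (suc d) = refl
Add-col (here {x} {xs}) d with <-cmp d x
... | tri< p q _ = trans (col-∷-> {suc x} {xs} (m<n⇒m<1+n p))
                    (cong₂ _+_ (sym (δ-≢ q)) (sym (col-∷-> {x} {xs} p)))
... | tri≈ _ refl _ = trans (col-∷-> {suc x} {xs} ≤-refl) (cong₂ _+_ (sym (δ-refl x)) (sym (col-∷-≤ {x} {xs} ≤-refl)))
... | tri> _ q p = trans (col-∷-≤ {suc x} {xs} p)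
                    (cong₂ _+_ (sym (δ-≢ q)) (sym (col-∷-≤ {x} {xs} (<⇒≤ p))))
Add-col (there {c} {x} {xs} {ys} a) d with d <? x
... | yes p = trans (col-∷-> {x} {ys} p) (trans (cong suc (Add-col a d))
                (trans (sym (+-suc (δ d c) (col xs d))) (cong (δ d c +_) (sym (col-∷-> {x} {xs} p)))))
... | no  p = trans (col-∷-≤ {x} {ys} (≮⇒≥ p)) (trans (Add-col a d) (cong (δ d c +_) (sym (col-∷-≤ {x} {xs} (≮⇒≥ p)))))

col-∷-Addable : ∀ {x xs} c → c < x → Addable (col (x ∷ xs)) c → Addable (col xs) c
col-∷-Addable zero p a = tt
col-∷-Addable {x} {xs} (suc c) p a =
  ≤-pred (subst₂ _<_ (col-∷-> {x} {xs} p) (col-∷-> {x} {xs} (<-trans (n<1+n c) p)) a)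

addBox : ∀ {b xs} c → Desc b xs → c < b → Addable (col xs) c → ∃ λ ys → Add c xs ys × Desc b ys
addBox zero    [] p a = 1 ∷ [] , new , cons ≤-refl p []
addBox {xs = x ∷ xs} c (cons q r d) p a with <-cmp c x
... | tri≈ _ refl _ = suc x ∷ xs , here , cons (s≤s z≤n) p (Desc-weaken (n≤1+n x) d)
... | tri< p′ _ _ with ys , A , D ← addBox c d p′ (col-∷-Addable c p′ a) = x ∷ ys , there A , cons q r D
addBox {xs = x ∷ xs} (suc c) (cons q r d) p a | tri> _ _ (s≤s p′)
  with () ← subst (col (x ∷ xs) (suc c) <_) (col-beyond (cons q ≤-refl d) p′) a

Desc-tighten : ∀ {b c xs} → Desc b xs → col xs c ≡ 0 → Desc c xs
Desc-tighten []                          e = []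
Desc-tighten {c = c} (cons {x} {xs} p q d) e with c <? x
... | no  r = cons p (≮⇒≥ r) d
... | yes r with () ← trans (sym (col-∷-> {x} {xs} r)) e

removeBox : ∀ {b xs} c → Desc b xs → Removable (col xs) c → ∃ λ ys → Add c ys xs × Desc b ys
removeBox {xs = x ∷ xs} c (cons q r d) a with <-cmp (suc c) x
... | tri< p _ _
  with ys , A , D ← removeBox c d (≤-pred (subst₂ _<_ (col-∷-> {x} {xs} p) (col-∷-> {x} {xs} (<-trans (n<1+n c) p)) a))
  = x ∷ ys , there A , cons q r D
... | tri> _ _ (s≤s p) with () ← subst (col (x ∷ xs) (suc c) <_) (col-beyond (cons q ≤-refl d) p) a
-- This row ends in column `c`, but the corner is here only if no lower row is as long.
removeBox {xs = x ∷ xs} c (cons q r d) a | tri≈ _ refl _ with 0 <? col xs c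
... | yes p with ys , A , D ← removeBox c d (subst (_< col xs c) (sym (col-beyond d ≤-refl)) p)
  = suc c ∷ ys , there A , cons q r D
removeBox {xs = x ∷ xs} zero    (cons q r d) a | tri≈ _ refl _ | no p
  with xs | Desc-tighten d (n≤0⇒n≡0 (≮⇒≥ p))
... | _ | [] = [] , new , []
... | _ | cons s s′ _ with () ← ≤-trans s s′
removeBox {xs = x ∷ xs} (suc c) (cons q r d) a | tri≈ _ refl _ | no p =
  suc c ∷ xs , here , cons (s≤s z≤n) (≤-trans (n≤1+n _) r) (Desc-tighten d (n≤0⇒n≡0 (≮⇒≥ p)))

==ℓ⇒≡ : ∀ {xs ys} → T (xs ==ℓ ys) → xs ≡ ys
==ℓ⇒≡ {xs} {ys} = toWitness {a? = ≡-dec Data.Nat._≟_ xs ys}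

==ℓ-refl : ∀ xs → T (xs ==ℓ xs)
==ℓ-refl xs = fromWitness {a? = ≡-dec Data.Nat._≟_ xs xs} refl

T⇒Add : ∀ xs ys → T (addsBox xs ys) → ∃ λ c → Add c xs ys
T⇒Add []       (y ∷ ys) t with p , q ← T∧⁻ {y ≡ᵇ 1} t
  with refl ← ≡ᵇ⇒≡ y 1 p | refl ← ==ℓ⇒≡ {ys} {[]} q = 0 , new
T⇒Add (x ∷ xs) (y ∷ ys) t with Equivalence.to (T-∨ {(y ≡ᵇ suc x) ∧ (xs ==ℓ ys)}) t
... | inj₁ s with p , q ← T∧⁻ {y ≡ᵇ suc x} s
             with refl ← ≡ᵇ⇒≡ y (suc x) p | refl ← ==ℓ⇒≡ {xs} {ys} q = x , here
... | inj₂ s with p , q ← T∧⁻ {x ≡ᵇ y} s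
             with refl ← ≡ᵇ⇒≡ x y p | c , A ← T⇒Add xs ys q = c , there A

Add⇒T : ∀ {c xs ys} → Add c xs ys → T (addsBox xs ys)
Add⇒T new                     = tt
Add⇒T (here {x} {xs})         = Equivalence.from (T-∨ {(suc x ≡ᵇ suc x) ∧ (xs ==ℓ xs)})
                                  (inj₁ (T∧ {suc x ≡ᵇ suc x} (≡⇒≡ᵇ x x refl) (==ℓ-refl xs)))
Add⇒T (there {c} {x} {xs} {ys} A) = Equivalence.from (T-∨ {(x ≡ᵇ suc x) ∧ (xs ==ℓ ys)})
                                  (inj₂ (T∧ {x ≡ᵇ x} (≡⇒≡ᵇ x x refl) (Add⇒T A)))

-- A run lists the diagrams in reverse order, the current one first.
data Run : List (List ℕ) → State → Set where
  start : Run ([] ∷ []) []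
  up    : ∀ {c xs ys l s} → Run (xs ∷ l) s → Add c xs ys → Part ys → Run (ys ∷ xs ∷ l) (op c ∷ s)
  down  : ∀ {c ρ xs ys l s s′} → Run (xs ∷ l) s → Add c ys xs → Part ys → Bump c ρ s s′ →
          Run (ys ∷ xs ∷ l) (cl (suc ρ) ∷ s′)

Run-Part : ∀ {xs l s} → Run (xs ∷ l) s → Part xs
Run-Part start          = 0 , []
Run-Part (up _ _ p)     = p
Run-Part (down _ _ p _) = p

col-Antitone : ∀ {xs} → Part xs → Antitone (col xs)
col-Antitone {[]}     (b , [])          c = z≤n
col-Antitone {x ∷ xs} (b , cons p q d) c with suc c <? x
... | yes r = subst₂ _≤_ (sym (col-∷-> {x} {xs} r)) (sym (col-∷-> {x} {xs} (<-trans (n<1+n c) r)))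
                (s≤s (col-Antitone (x , d) c))
... | no  r = subst (_≤ col (x ∷ xs) c) (sym (col-beyond (cons p ≤-refl d) (≮⇒≥ r))) z≤n

Bump-col : ∀ {c ρ xs ys s s′} → (∀ d → #op s d ≡ col xs d) → Add c ys xs → Bump c ρ s s′ →
           ∀ d → #op s′ d ≡ col ys d
Bump-col {c} e A b d = +-cancelˡ-≡ (δ d c) _ _ (trans (sym (Bump-#op b d)) (trans (e d) (Add-col A d)))

Run-col : ∀ {xs l s} → Run (xs ∷ l) s → ∀ d → #op s d ≡ col xs d
Run-col start          d = refl
Run-col (up {c} r A _) d = trans (cong (δ d c +_) (Run-col r d)) (sym (Add-col A d))
Run-col (down {s = s} {s′} r A _ b) = Bump-col {s = s} {s′} (Run-col r) A b

Run-Good : ∀ {xs l s} → Run (xs ∷ l) s → Good s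
Run-Good start = good tt tt (λ _ → refl)
Run-Good (up {c} {xs} {ys} r A p) =
  Good-up (Run-Good r) (Addable-cong c (Run-col r) (remove-Addable {col ys} (Add-col A) (col-Antitone p)))
Run-Good (down {c} {xs = xs} r A p b) =
  Good-down (Run-Good r) (Removable-cong c (Run-col r) (add-Removable {col xs} (Add-col A) (col-Antitone p))) b

Run-length : ∀ {l s} → Run l s → length l ≡ suc (length s)
Run-length start          = refl
Run-length (up r _ _)     = cong suc (Run-length r)
Run-length (down r _ _ b) = cong suc (trans (Run-length r) (cong suc (Bump-length b)))

Run-det : ∀ {l s s′} → Run l s → Run l s′ → s ≡ s′
Run-det start start = refl
Run-det (up r A _) (up r′ A′ _) with refl ← Run-det r r′ = cong (λ c → op c ∷ _) (Add-det A A′)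
Run-det (down r A _ b) (down r′ A′ _ b′) with refl ← Run-det r r′ with Add-det A A′
... | refl with refl , refl ← Bump-det b b′ = refl
Run-det (up r A _) (down r′ A′ _ b′) = ⊥-elim (Add-asym A A′)
Run-det (down r A _ b) (up r′ A′ _) = ⊥-elim (Add-asym A A′)

-- The recursion is on the length: undoing a deletion replaces the tail of the state by another list
-- of the same length.
run : ∀ s → Good s → ∃ λ xs → ∃ λ l → Run (xs ∷ l) s
run s = go (length s) s refl
  where
  go : ∀ n s → length s ≡ n → Good s → ∃ λ xs → ∃ λ l → Run (xs ∷ l) s
  go zero    []         e g = [] , [] , start
  go (suc n) (op c ∷ s) e g with g′ , a ← Good-up⁻ g with xs , l , r ← go n s (suc-injective e) g′
    with b , d ← Run-Part r
    with ys , A , D ← addBox c (Desc-weaken (m≤m⊔n b (suc c)) d) (m≤n⊔m b (suc c))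
                        (Addable-cong c (λ d → sym (Run-col r d)) a)
    = ys , xs ∷ l , up r A (_ , D)
  go (suc n) (cl e′ ∷ s′) e g with c , ρ , s , refl , b , g′ , a ← Good-down⁻ g
    with xs , l , r ← go n s (trans (Bump-length b) (suc-injective e)) g′
    with B , d ← Run-Part r
    with ys , A , D ← removeBox c d (Removable-cong c (λ d → sym (Run-col r d)) a)
    = ys , xs ∷ l , down r A (_ , D) b

Run-det⁻ : ∀ {l l′ s} → Run l s → Run l′ s → l ≡ l′
Run-det⁻ start start = refl
Run-det⁻ {s = s} r@(up r₁ _ (_ , d)) r′@(up r₁′ _ (_ , d′)) =
  cong₂ _∷_ (col-injective d d′ (λ c → trans (sym (Run-col r c)) (Run-col r′ c))) (Run-det⁻ r₁ r₁′)
Run-det⁻ r@(down r₁ _ (_ , d) b) r′@(down r₁′ _ (_ , d′) b′) with _ , refl ← Bump-det⁻ b b′ =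
  cong₂ _∷_ (col-injective d d′ (λ c → trans (sym (Run-col r c)) (Run-col r′ c))) (Run-det⁻ r₁ r₁′)

boundedPart : ℕ → List ℕ → Bool
boundedPart k p = isPartition p ∧ (height p ≤ᵇ k)

T⇒step : ∀ xs ys → T (oneStep xs ys) → (∃ λ c → Add c xs ys) ⊎ (∃ λ c → Add c ys xs)
T⇒step xs ys t with Equivalence.to (T-∨ {addsBox xs ys}) t
... | inj₁ a = inj₁ (T⇒Add xs ys a)
... | inj₂ a = inj₂ (T⇒Add ys xs a)

extend : ∀ {xs ys l s} → Run (xs ∷ l) s → T (oneStep xs ys) → Part ys → ∃ λ s′ → Run (ys ∷ xs ∷ l) s′
extend {xs} {ys} {s = s} r t p with T⇒step xs ys t
... | inj₁ (c , A) = op c ∷ s , up r A p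
... | inj₂ (c , A)
  with rem ← Removable-cong {#op s} {col xs} c (Run-col r) (add-Removable {col xs} (Add-col A) (col-Antitone p))
  with ρ , s′ , b ← bump c s (opLat (Run-Good r)) (≤-trans (s≤s z≤n) rem)
  = cl (suc ρ) ∷ s′ , down r A p b

osc⇒run′ : ∀ k e a acc r {s} → Run (a ∷ acc) s → All (λ p → length p ≤ k) (a ∷ acc) →
           T (endsAt e (a ∷ r)) → T (consecutiveSteps (a ∷ r)) → T (all (boundedPart k) r) →
           ∃ λ l → ∃ λ s′ → r ʳ++ (a ∷ acc) ≡ e ∷ l × Run (e ∷ l) s′ × All (λ p → length p ≤ k) (e ∷ l)
osc⇒run′ k e a acc []      R A t c h with refl ← ==ℓ⇒≡ {a} {e} t = acc , _ , refl , R , A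
osc⇒run′ k e a acc (b ∷ r) R A t c h
  with c₁ , c₂ ← T∧⁻ {oneStep a b} c | h₁ , h₂ ← T∧⁻ {boundedPart k b} h
  with p , q ← T∧⁻ {isPartition b} h₁
  with _ , R′ ← extend R c₁ (T⇒Part p)
  = osc⇒run′ k e b (a ∷ acc) r R′ (≤ᵇ⇒≤ (length b) k q ∷ A) t c₂ h₂

osc⇒run : ∀ k e xs → T (isOscillating k e xs) →
          ∃ λ l → ∃ λ s → reverse xs ≡ e ∷ l × Run (e ∷ l) s × All (λ p → length p ≤ k) (e ∷ l)
osc⇒run k e (a ∷ r) t
  with t₁ , t′ ← T∧⁻ {a ==ℓ []} t
  with t₂ , t″ ← T∧⁻ {endsAt e (a ∷ r)} t′
  with t₃ , t₄ ← T∧⁻ {consecutiveSteps (a ∷ r)} t″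
  with refl ← ==ℓ⇒≡ {a} {[]} t₁ = osc⇒run′ k e [] [] r start (z≤n ∷ []) t₂ t₃ t₄

Add⇒oneStep : ∀ {c xs ys} → Add c xs ys ⊎ Add c ys xs → T (oneStep xs ys)
Add⇒oneStep {xs = xs} {ys} (inj₁ a) = Equivalence.from (T-∨ {addsBox xs ys}) (inj₁ (Add⇒T a))
Add⇒oneStep {xs = xs} {ys} (inj₂ a) = Equivalence.from (T-∨ {addsBox xs ys}) (inj₂ (Add⇒T a))

run⇒osc′ : ∀ k e a acc r {s} → Run (a ∷ acc) s → All (λ p → length p ≤ k) (a ∷ acc) →
           T (endsAt e (a ∷ r)) → T (consecutiveSteps (a ∷ r)) → T (all (boundedPart k) r) →
           T (isOscillating k e (acc ʳ++ (a ∷ r)))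
run⇒osc″ : ∀ k e a b acc r {c s} → Run (b ∷ acc) s → Part a → All (λ p → length p ≤ k) (a ∷ b ∷ acc) →
           Add c b a ⊎ Add c a b →
           T (endsAt e (a ∷ r)) → T (consecutiveSteps (a ∷ r)) → T (all (boundedPart k) r) →
           T (isOscillating k e (acc ʳ++ (b ∷ a ∷ r)))
run⇒osc′ k e a acc r start _ t c h = T∧ {endsAt e (a ∷ r)} t (T∧ {consecutiveSteps (a ∷ r)} c h)
run⇒osc′ k e a (b ∷ acc) r (up R A p)     hs = run⇒osc″ k e a b acc r R p hs (inj₁ A)
run⇒osc′ k e a (b ∷ acc) r (down R A p _) hs = run⇒osc″ k e a b acc r R p hs (inj₂ A)
run⇒osc″ k e a b acc r R p (q ∷ hs) A t c h =
  run⇒osc′ k e b acc (a ∷ r) R hs t (T∧ {oneStep b a} (Add⇒oneStep A) c)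
    (T∧ {boundedPart k a} (T∧ {isPartition a} (Part⇒T p) (≤⇒≤ᵇ q)) h)

run⇒osc : ∀ k e l {s} → Run (e ∷ l) s → All (λ p → length p ≤ k) (e ∷ l) →
          T (isOscillating k e (reverse (e ∷ l)))
run⇒osc k e l R hs = run⇒osc′ k e e l [] R hs (==ℓ-refl e) tt tt

-- Standard Young tableaux

data Asc (b : ℕ) : List ℕ → Set where
  []  : Asc b []
  asc : ∀ {x xs} → b ≤ x → Asc (suc x) xs → Asc b (x ∷ xs)

data _⊳_ : List ℕ → List ℕ → Set where
  []  : ∀ {xs} → xs ⊳ []
  _∷_ : ∀ {x y xs ys} → x < y → xs ⊳ ys → (x ∷ xs) ⊳ (y ∷ ys)

Under : List ℕ → List (List ℕ) → Set
Under r []      = ⊤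
Under r (s ∷ _) = r ⊳ s

data YT : List (List ℕ) → Set where
  []  : YT []
  row : ∀ {x r rs} → Asc 0 (x ∷ r) → Under (x ∷ r) rs → YT rs → YT ((x ∷ r) ∷ rs)

Asc⇒T : ∀ {b} r → Asc b r → T (strictlyIncreasing r)
Asc⇒T []          _                     = tt
Asc⇒T (x ∷ [])    _                     = tt
Asc⇒T (x ∷ y ∷ r) (asc _ a@(asc p _)) = T∧ (<⇒<ᵇ p) (Asc⇒T (y ∷ r) a)

T⇒Asc : ∀ {b x} r → b ≤ x → T (strictlyIncreasing (x ∷ r)) → Asc b (x ∷ r)
T⇒Asc []              p t = asc p []
T⇒Asc {x = x} (y ∷ r) p t with t₁ , t₂ ← T∧⁻ {x <ᵇ y} t = asc p (T⇒Asc r (<ᵇ⇒< x y t₁) t₂)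

⊳⇒T : ∀ {r s} → r ⊳ s → T (and (zipWith _<ᵇ_ r s))
⊳⇒T {[]}    []      = tt
⊳⇒T {x ∷ r} []      = tt
⊳⇒T         (p ∷ q) = T∧ (<⇒<ᵇ p) (⊳⇒T q)

⊳⇒≤ : ∀ {r s} → r ⊳ s → length s ≤ length r
⊳⇒≤ []      = z≤n
⊳⇒≤ (p ∷ q) = s≤s (⊳⇒≤ q)

T⇒⊳ : ∀ r s → length s ≤ length r → T (and (zipWith _<ᵇ_ r s)) → r ⊳ s
T⇒⊳ r       []      p       t = []
T⇒⊳ (x ∷ r) (y ∷ s) (s≤s p) t with t₁ , t₂ ← T∧⁻ {x <ᵇ y} t = <ᵇ⇒< x y t₁ ∷ T⇒⊳ r s p t₂

YT⇒Desc : ∀ {rs} → YT rs → ∀ {b} → (∀ {r l} → rs ≡ r ∷ l → length r ≤ b) → Desc b (shape rs)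
YT⇒Desc []                  h = []
YT⇒Desc (row {rs = rs} _ u y) h = cons (s≤s z≤n) (h refl) (YT⇒Desc y (λ { refl → ⊳⇒≤ u }))

YT⇒T : ∀ {rs} → YT rs → T (isPartition (shape rs)) × T (all strictlyIncreasing rs) × T (columnsIncrease rs)
YT⇒T {rs} y = Part⇒T (part rs y) , rows y , cols y
  where
  part : ∀ rs → YT rs → Part (shape rs)
  part []      _ = 0 , []
  part (r ∷ _) y = length r , YT⇒Desc y (λ { refl → ≤-refl })
  rows : ∀ {rs} → YT rs → T (all strictlyIncreasing rs)
  rows []                      = tt
  rows (row {x} {r} a _ y) = T∧ {strictlyIncreasing (x ∷ r)} (Asc⇒T _ a) (rows y)
  cols : ∀ {rs} → YT rs → T (columnsIncrease rs)
  cols []                                      = tt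
  cols (row _ _ [])                            = tt
  cols (row {x} {r} _ u y@(row {x′} {r′} _ _ _)) =
    T∧ {and (zipWith _<ᵇ_ (x ∷ r) (x′ ∷ r′))} (⊳⇒T u) (cols y)

T⇒YT : ∀ rs → T (isPartition (shape rs)) → T (all strictlyIncreasing rs) → T (columnsIncrease rs) → YT rs
T⇒YT rs p = go rs (proj₂ (T⇒Part p))
  where
  go : ∀ rs {b} → Desc b (shape rs) → T (all strictlyIncreasing rs) → T (columnsIncrease rs) → YT rs
  go []                   d            i c = []
  go ([] ∷ rs)            (cons () _ _) i c
  go ((x ∷ r) ∷ [])       (cons _ _ d) i c = row (T⇒Asc r z≤n (proj₁ (T∧⁻ {strictlyIncreasing (x ∷ r)} i))) tt []
  go ((x ∷ r) ∷ s ∷ rs) (cons _ _ d@(cons _ q _)) i c =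
    row (T⇒Asc r z≤n (proj₁ i′)) (T⇒⊳ (x ∷ r) s q (proj₁ c′)) (go (s ∷ rs) d (proj₂ i′) (proj₂ c′))
    where
    i′ = T∧⁻ {strictlyIncreasing (x ∷ r)} i
    c′ = T∧⁻ {and (zipWith _<ᵇ_ (x ∷ r) s)} c

count-∷ : ∀ i x xs → count i (x ∷ xs) ≡ δ i x + count i xs
count-∷ i x xs with i ≟ x
... | yes p@refl = trans (cong length (filter-accept (i ≟_) {x} {xs} p)) (cong (_+ count i xs) (sym (δ-refl i)))
... | no  p    = trans (cong length (filter-reject (i ≟_) {x} {xs} p)) (cong (_+ count i xs) (sym (δ-≢ p)))

count-++ : ∀ i xs ys → count i (xs ++ ys) ≡ count i xs + count i ys
count-++ i []       ys = refl
count-++ i (x ∷ xs) ys = trans (count-∷ i x (xs ++ ys)) (trans (cong (δ i x +_) (count-++ i xs ys))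
  (trans (sym (+-assoc (δ i x) _ _)) (cong (_+ count i ys) (sym (count-∷ i x xs)))))

count-insert : ∀ i xs v ys → count i (xs ++ v ∷ ys) ≡ δ i v + count i (xs ++ ys)
count-insert i []       v ys = count-∷ i v ys
count-insert i (x ∷ xs) v ys = trans (count-∷ i x (xs ++ v ∷ ys)) (trans (cong (δ i x +_) (count-insert i xs v ys))
  (trans (+-swap (δ i x) (δ i v) _) (cong (δ i v +_) (sym (count-∷ i x (xs ++ ys))))))

length-insert : ∀ (xs : List ℕ) v ys → length (xs ++ v ∷ ys) ≡ suc (length (xs ++ ys))
length-insert []       v ys = refl
length-insert (x ∷ xs) v ys = cong suc (length-insert xs v ys)

count-∈ : ∀ v xs → 0 < count v xs → v ∈ xs
count-∈ v (x ∷ xs) p with subst (0 <_) (count-∷ v x xs) p | v ≟ x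
... | _ | yes refl = here refl
... | q | no  n    = there (count-∈ v xs (subst (λ z → 0 < z + count v xs) (δ-≢ n) q))

Ent : ℕ → List ℕ → Set
Ent n xs = length xs ≡ n × (∀ {i} → i < n → count (suc i) xs ≡ 1)

T⇒Ent : ∀ n xs → T (entriesOneToN n xs) → Ent n xs
T⇒Ent n xs t with p , q ← T∧⁻ {length xs ≡ᵇ n} t =
  ≡ᵇ⇒≡ (length xs) n p , λ {i} r → ≡ᵇ⇒≡ (count (suc i) xs) 1 (applyUpTo⁻ _ n (all⁺ _ (upTo n) q) r)

Ent⇒T : ∀ n xs → Ent n xs → T (entriesOneToN n xs)
Ent⇒T n xs (p , q) = T∧ {length xs ≡ᵇ n} (≡⇒≡ᵇ (length xs) n p)
  (all⁻ (λ i → count (suc i) xs ≡ᵇ 1) (applyUpTo⁺₁ _ n (λ {i} r → ≡⇒≡ᵇ (count (suc i) xs) 1 (q r))))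

Ent-insert⁻ : ∀ {n} xs ys → length xs ≡ suc (length ys) → (∀ i → count i xs ≡ δ i (suc n) + count i ys) →
              Ent (suc n) xs → Ent n ys
Ent-insert⁻ {n} xs ys l c (p , q) = suc-injective (trans (sym l) p) ,
  λ {i} r → trans (sym (trans (c (suc i)) (cong (_+ count (suc i) ys) (δ-≢ (<⇒≢ (s≤s r)))))) (q (m<n⇒m<1+n r))

Ent-∈ : ∀ {n xs} → Ent (suc n) xs → suc n ∈ xs
Ent-∈ {n} {xs} (_ , q) = count-∈ (suc n) xs (subst (0 <_) (sym (q ≤-refl)) (s≤s z≤n))

-- By counting, no entry is left over.
Ent-≤ : ∀ n xs → Ent n xs → All (_≤ n) xs
Ent-≤ zero    []       e = []
Ent-≤ (suc n) xs       e with ys , zs , refl ← ∈-∃++ (Ent-∈ {n} {xs} e)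
  with a , b ← ++⁻ ys (Ent-≤ n (ys ++ zs) (Ent-insert⁻ (ys ++ suc n ∷ zs) (ys ++ zs) (length-insert ys (suc n) zs)
                 (λ i → count-insert i ys (suc n) zs) e))
  = ++⁺ (All.map m≤n⇒m≤1+n a) (≤-refl ∷ All.map m≤n⇒m≤1+n b)

data Ins (v : ℕ) : ℕ → List (List ℕ) → List (List ℕ) → Set where
  new   : Ins v 0 [] ((v ∷ []) ∷ [])
  here  : ∀ {x r rs} → Ins v 0 ((x ∷ r) ∷ rs) ((x ∷ r ∷ʳ v) ∷ rs)
  there : ∀ {i r rs rs′} → Ins v i rs rs′ → Ins v (suc i) (r ∷ rs) (r ∷ rs′)

Ins-det : ∀ {v i rs s s′} → Ins v i rs s → Ins v i rs s′ → s ≡ s′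
Ins-det new       new       = refl
Ins-det here      here      = refl
Ins-det (there a) (there b) = cong (_ ∷_) (Ins-det a b)

∷ʳ-≮ : ∀ r v → ¬ All (_< v) (r ∷ʳ v)
∷ʳ-≮ []      v (p ∷ _) = <-irrefl refl p
∷ʳ-≮ (x ∷ r) v (_ ∷ a) = ∷ʳ-≮ r v a

Ins-det⁻ : ∀ {v i i′ rs rs′ s s′} → Ins v i rs s → Ins v i′ rs′ s′ → s ≡ s′ →
           All (All (_< v)) rs → All (All (_< v)) rs′ → i ≡ i′ × rs ≡ rs′
Ins-det⁻ new new e a a′ = refl , refl
Ins-det⁻ new (here {r = []}) () a a′
Ins-det⁻ new (here {r = _ ∷ _}) () a a′
Ins-det⁻ (here {r = []}) new () a a′
Ins-det⁻ (here {r = _ ∷ _}) new () a a′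
Ins-det⁻ {v} new (there _) refl a (b ∷ _) = ⊥-elim (∷ʳ-≮ [] v b)
Ins-det⁻ {v} (there _) new refl (b ∷ _) a = ⊥-elim (∷ʳ-≮ [] v b)
Ins-det⁻ (here {x} {r} {rs}) (here {x′} {r′}) e a a′
  with e₁ , refl ← ∷-injective e with refl , _ ← ∷ʳ-injective (x ∷ r) (x′ ∷ r′) e₁ = refl , refl
Ins-det⁻ {v} (here {x} {r}) (there _) refl a (b ∷ _) = ⊥-elim (∷ʳ-≮ (x ∷ r) v b)
Ins-det⁻ {v} (there _) (here {x} {r}) refl (b ∷ _) a = ⊥-elim (∷ʳ-≮ (x ∷ r) v b)
Ins-det⁻ (there p) (there q) e (_ ∷ a) (_ ∷ a′) with refl , e′ ← ∷-injective e
  with refl , refl ← Ins-det⁻ p q e′ a a′ = refl , refl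

Ins-count : ∀ {v i rs rs′} → Ins v i rs rs′ → ∀ j → count j (concat rs′) ≡ δ j v + count j (concat rs)
Ins-count {v} new j = count-∷ j v []
Ins-count {v} (here {x} {r} {rs}) j = trans (cong (count j) (++-∷ʳ (x ∷ r) (concat rs))) (count-insert j (x ∷ r) v (concat rs))
  where
  ++-∷ʳ : ∀ (r s : List ℕ) → (r ∷ʳ v) ++ s ≡ r ++ v ∷ s
  ++-∷ʳ []      s = refl
  ++-∷ʳ (x ∷ r) s = cong (x ∷_) (++-∷ʳ r s)
Ins-count {v} (there {r = r} {rs} {rs′} p) j = trans (count-++ j r (concat rs′)) (trans (cong (count j r +_) (Ins-count p j))
  (trans (+-swap (count j r) (δ j v) _) (cong (δ j v +_) (sym (count-++ j r (concat rs))))))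

Ins-length : ∀ {v i rs rs′} → Ins v i rs rs′ → length (concat rs′) ≡ suc (length (concat rs))
Ins-length new = refl
Ins-length {v} (here {x} {r} {rs}) = cong suc (go r)
  where
  go : ∀ r → length ((r ∷ʳ v) ++ concat rs) ≡ suc (length (r ++ concat rs))
  go []      = refl
  go (x ∷ r) = cong suc (go r)
Ins-length (there {r = r} {rs} {rs′} p) = trans (length-++ r) (trans (cong (length r +_) (Ins-length p))
  (trans (+-suc (length r) _) (cong suc (sym (length-++ r)))))

Ins-All : ∀ {P : ℕ → Set} {v i rs rs′} → Ins v i rs rs′ → P v → All (All P) rs → All (All P) rs′
Ins-All new       p a       = (p ∷ []) ∷ []
Ins-All here      p (a ∷ b) = ++⁺ a (p ∷ []) ∷ b
Ins-All (there i) p (a ∷ b) = a ∷ Ins-All i p b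

nth : List ℕ → ℕ → ℕ
nth []       i       = 0
nth (x ∷ xs) zero    = x
nth (x ∷ xs) (suc i) = nth xs i

Ins-nth : ∀ {v i rs rs′} → Ins v i rs rs′ → nth (shape rs′) ≗ nth (shape rs) +[ i ]
Ins-nth new               zero    = refl
Ins-nth new               (suc d) = refl
Ins-nth {v} (here {x} {r}) zero    = cong suc (trans (length-++ r) (+-comm (length r) 1))
Ins-nth here              (suc d) = refl
Ins-nth (there i)         zero    = refl
Ins-nth (there i)         (suc d) = Ins-nth i d

YT-Antitone : ∀ {rs} → YT rs → Antitone (nth (shape rs))
YT-Antitone []            d       = z≤n
YT-Antitone (row {rs = []}    _ u y) zero    = z≤n
YT-Antitone (row {rs = _ ∷ _} _ u y) zero    = ⊳⇒≤ u
YT-Antitone (row              _ u y) (suc d) = YT-Antitone y d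

Asc-∷ʳ : ∀ {b v} r → b ≤ v → Asc b r → All (_< v) r → Asc b (r ∷ʳ v)
Asc-∷ʳ []      p []        a       = asc p []
Asc-∷ʳ (x ∷ r) p (asc q s) (l ∷ a) = asc q (Asc-∷ʳ r l s a)

Asc-∷ʳ⁻ : ∀ {b v} r → Asc b (r ∷ʳ v) → Asc b r
Asc-∷ʳ⁻ []      _         = []
Asc-∷ʳ⁻ (x ∷ r) (asc p a) = asc p (Asc-∷ʳ⁻ r a)

Asc-last : ∀ {b v} r → Asc b r → All (_≤ v) r → v ∈ r → ∃ λ r₀ → r ≡ r₀ ∷ʳ v
Asc-last (x ∷ [])    a                   l       (here refl) = [] , refl
Asc-last (x ∷ y ∷ r) (asc _ (asc p _)) (_ ∷ l ∷ _) (here refl) = ⊥-elim (<⇒≱ p l)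
Asc-last (x ∷ r)     (asc _ a)           (_ ∷ l) (there i) with r₀ , refl ← Asc-last r a l i = x ∷ r₀ , refl

⊳-∷ʳˡ : ∀ {v} r s → r ⊳ s → (r ∷ʳ v) ⊳ s
⊳-∷ʳˡ r       []      p       = []
⊳-∷ʳˡ (x ∷ r) (y ∷ s) (p ∷ q) = p ∷ ⊳-∷ʳˡ r s q

⊳-∷ʳˡ⁻ : ∀ {v} r s → All (_≤ v) s → (r ∷ʳ v) ⊳ s → r ⊳ s
⊳-∷ʳˡ⁻ r       []      a       p       = []
⊳-∷ʳˡ⁻ []      (y ∷ s) (l ∷ a) (p ∷ q) = ⊥-elim (<⇒≱ p l)
⊳-∷ʳˡ⁻ (x ∷ r) (y ∷ s) (l ∷ a) (p ∷ q) = p ∷ ⊳-∷ʳˡ⁻ r s a q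

⊳-∷ʳʳ : ∀ {v} r s → All (_< v) r → length s < length r → r ⊳ s → r ⊳ (s ∷ʳ v)
⊳-∷ʳʳ (x ∷ r) []      (l ∷ a) p       q       = l ∷ []
⊳-∷ʳʳ (x ∷ r) (y ∷ s) (_ ∷ a) (s≤s p) (l ∷ q) = l ∷ ⊳-∷ʳʳ r s a p q

⊳-∷ʳʳ⁻ : ∀ {v} r s → r ⊳ (s ∷ʳ v) → r ⊳ s
⊳-∷ʳʳ⁻ r       []      p       = []
⊳-∷ʳʳ⁻ (x ∷ r) (y ∷ s) (l ∷ p) = l ∷ ⊳-∷ʳʳ⁻ r s p

nth-Addable : ∀ {x xs} i → Addable (nth (x ∷ xs)) (suc i) → Addable (nth xs) i
nth-Addable zero    p = tt
nth-Addable (suc i) p = p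

-- The last component tells how the result fits under one more row. An entry appended to the top row
-- needs a box above it, and addability one row further down provides that box.
insertMax : ∀ {v} i rs → YT rs → All (All (_< v)) rs → Addable (nth (shape rs)) i →
            ∃ λ rs′ → Ins v i rs rs′ × YT rs′ ×
              (∀ r → Under r rs → All (_< v) r → (i ≡ 0 → nth (shape rs) 0 < length r) → Under r rs′)
insertMax {v} zero [] y a p = (v ∷ []) ∷ [] , new , row (asc z≤n []) tt [] , u
  where
  u : ∀ r → ⊤ → All (_< v) r → (0 ≡ 0 → 0 < length r) → r ⊳ (v ∷ [])
  u []      _ _       h with () ← h refl
  u (x ∷ r) _ (l ∷ _) h = l ∷ []
insertMax {v} zero ((x ∷ r) ∷ rs) (row s u y) (a ∷ b) p =
  (x ∷ r ∷ʳ v) ∷ rs , here , row (Asc-∷ʳ (x ∷ r) z≤n s a) (under rs u) y ,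
  λ q t l h → ⊳-∷ʳʳ q (x ∷ r) l (h refl) t
  where
  under : ∀ rs → Under (x ∷ r) rs → Under (x ∷ r ∷ʳ v) rs
  under []      _ = tt
  under (s ∷ _) u = ⊳-∷ʳˡ (x ∷ r) s u
insertMax zero ([] ∷ rs) () a p
insertMax (suc i) ((x ∷ r) ∷ rs) (row s u y) (a ∷ b) p
  with rs′ , I , y′ , u′ ← insertMax i rs y b (nth-Addable i p)
  = (x ∷ r) ∷ rs′ , there I , row s (u′ (x ∷ r) u a λ { refl → p }) y′ , λ _ t _ _ → t

removeMax : ∀ {v} rs → YT rs → All (All (_≤ v)) rs → v ∈ concat rs →
            ∃ λ i → ∃ λ rs₀ → Ins v i rs₀ rs × YT rs₀ × (∀ r → Under r rs → Under r rs₀)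
removeMax {v} (r ∷ rs) y a m with ∈-++⁻ r m
removeMax {v} (.(x ∷ r) ∷ rs) (row {x} {r} s u y) (a ∷ b) m | inj₁ n with Asc-last (x ∷ r) s a n
... | z ∷ r₀ , refl = 0 , (z ∷ r₀) ∷ rs , here , row (Asc-∷ʳ⁻ (z ∷ r₀) s) (under rs u b) y , λ q → ⊳-∷ʳʳ⁻ q (z ∷ r₀)
  where
  under : ∀ rs → Under (z ∷ r₀ ∷ʳ v) rs → All (All (_≤ v)) rs → Under (z ∷ r₀) rs
  under []      u b       = tt
  under (s ∷ _) u (b ∷ _) = ⊳-∷ʳˡ⁻ (z ∷ r₀) s b u
removeMax {v} (.(x ∷ r) ∷ []) (row {x} {r} s u y) (a ∷ b) m | inj₁ n | [] , refl =
  0 , [] , new , [] , λ _ _ → tt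
removeMax {v} (.(x ∷ r) ∷ _) (row {x} {r} s (p ∷ _) (row _ _ _)) (a ∷ (l ∷ _) ∷ _) m | inj₁ n | [] , refl =
  ⊥-elim (<⇒≱ p l)
removeMax {v} (.(x ∷ r) ∷ rs) (row {x} {r} s u y) (a ∷ b) m | inj₂ n with i , rs₀ , I , y₀ , u₀ ← removeMax rs y b n =
  suc i , (x ∷ r) ∷ rs₀ , there I , row s (u₀ _ u) y₀ , λ _ t → t

-- The lattice word of a standard tableau: the label at position `p` is the row of the entry
-- `p + 1`, as positions start from 0 and entries from 1.
data Tab : List (List ℕ) → State → Set where
  []  : Tab [] []
  add : ∀ {i rs rs′ s} → Tab rs s → Ins (suc (length s)) i rs rs′ → YT rs′ → Tab rs′ (cl i ∷ s)

Tab-YT : ∀ {rs s} → Tab rs s → YT rs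
Tab-YT []          = []
Tab-YT (add _ _ y) = y

Tab-< : ∀ {rs s} → Tab rs s → All (All (_< suc (length s))) rs
Tab-< []          = []
Tab-< (add t I _) = Ins-All I ≤-refl (All.map (All.map m<n⇒m<1+n) (Tab-< t))

Tab-nth : ∀ {rs s} → Tab rs s → ∀ d → #cl s d ≡ nth (shape rs) d
Tab-nth []              d = refl
Tab-nth (add {i} t I _) d = trans (cong (δ d i +_) (Tab-nth t d)) (sym (Ins-nth I d))

Tab-ClLat : ∀ {rs s} → Tab rs s → ClLat s
Tab-ClLat []                    = tt
Tab-ClLat (add {i} {rs′ = rs′} t I y) =
  Addable-cong i (Tab-nth t) (remove-Addable {nth (shape rs′)} (Ins-nth I) (YT-Antitone y)) , Tab-ClLat t

Tab-noOp : ∀ {rs s} → Tab rs s → ∀ d → #op s d ≡ 0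
Tab-noOp []          d = refl
Tab-noOp (add t _ _) d = Tab-noOp t d

Tab-det : ∀ {rs rs′ s} → Tab rs s → Tab rs′ s → rs ≡ rs′
Tab-det [] [] = refl
Tab-det (add t I _) (add t′ I′ _) with refl ← Tab-det t t′ = Ins-det I I′

Tab-length : ∀ {rs s} → Tab rs s → length (concat rs) ≡ length s
Tab-length []          = refl
Tab-length (add t I _) = trans (Ins-length I) (cong suc (Tab-length t))

Tab-det⁻ : ∀ {rs s s′} → Tab rs s → Tab rs s′ → s ≡ s′
Tab-det⁻ [] [] = refl
Tab-det⁻ [] (add _ () _)
Tab-det⁻ T@(add {i} {s = s} t I y) T′@(add {i′} {s = s′} t′ I′ y′)
  with e ← suc-injective (trans (sym (Tab-length T)) (Tab-length T′))
  with refl , refl ← Ins-det⁻ (subst (λ n → Ins (suc n) i _ _) e I) I′ refl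
         (subst (λ n → All (All (_< suc n)) _) e (Tab-< t)) (Tab-< t′)
  = cong (cl i ∷_) (Tab-det⁻ t t′)

Tab-Ent : ∀ {rs s} → Tab rs s → Ent (length s) (concat rs)
Tab-Ent [] = refl , λ ()
Tab-Ent T@(add {rs = rs} {rs′} {s = s} t I y) = Tab-length T , ent
  where
  none : ∀ xs → All (_< suc (length s)) xs → count (suc (length s)) xs ≡ 0
  none []       []      = refl
  none (x ∷ xs) (p ∷ a) = trans (count-∷ (suc (length s)) x xs) (cong₂ _+_ (δ-≢ (λ e → <⇒≢ p (sym e))) (none xs a))
  ent : ∀ {i} → i < suc (length s) → count (suc i) (concat rs′) ≡ 1
  ent {i} p with i ≟ length s
  ... | yes refl = trans (Ins-count I (suc i)) (cong₂ _+_ (δ-refl i) (none (concat rs) (concat⁺′ (Tab-< t))))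
    where
    concat⁺′ : ∀ {rs} → All (All (_< suc (length s))) rs → All (_< suc (length s)) (concat rs)
    concat⁺′ []      = []
    concat⁺′ (a ∷ b) = ++⁺ a (concat⁺′ b)
  ... | no  q    = trans (Ins-count I (suc i)) (cong₂ _+_ (δ-≢ q) (proj₂ (Tab-Ent t) (≤∧≢⇒< (≤-pred p) q)))

tab : ∀ s → ClLat s → (∀ d → #op s d ≡ 0) → ∃ λ rs → Tab rs s
tab []         l       z = [] , []
tab (op c ∷ s) l       z with () ← trans (sym (cong (_+ #op s c) (δ-refl c))) (z c)
tab (cl i ∷ s) (a , l) z with rs , t ← tab s l z
  with rs′ , I , y , _ ← insertMax i rs (Tab-YT t) (Tab-< t) (Addable-cong i (λ d → sym (Tab-nth t d)) a)
  = rs′ , add t I y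

syt⇒tab′ : ∀ n rs → YT rs → Ent n (concat rs) → ∃ λ s → length s ≡ n × Tab rs s
syt⇒tab′ zero    []                 y e       = [] , refl , []
syt⇒tab′ zero    ((x ∷ r) ∷ rs)     y (() , _)
syt⇒tab′ zero    ([] ∷ rs)          () e
syt⇒tab′ (suc n) rs y e
  with i , rs₀ , I , y₀ , _ ← removeMax rs y (concat⁻ (Ent-≤ (suc n) (concat rs) e)) (Ent-∈ {n} {concat rs} e)
  with s , refl , t ← syt⇒tab′ n rs₀ y₀ (Ent-insert⁻ (concat rs) (concat rs₀) (Ins-length I) (Ins-count I) e)
  = cl i ∷ s , refl , add t I y

syt⇒tab : ∀ n rs → T (isSYT n rs) → ∃ λ s → length s ≡ n × Tab rs s
syt⇒tab n rs t
  with t₁ , t′ ← T∧⁻ {isPartition (shape rs)} t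
  with t₂ , t″ ← T∧⁻ {all strictlyIncreasing rs} t′
  with t₃ , t₄ ← T∧⁻ {columnsIncrease rs} t″
  = syt⇒tab′ n rs (T⇒YT rs t₁ t₂ t₃) (T⇒Ent n (concat rs) t₄)

tab⇒syt : ∀ {rs s} → Tab rs s → T (isSYT (length s) rs)
tab⇒syt {rs} {s} t with t₁ , t₂ , t₃ ← YT⇒T (Tab-YT t) =
  T∧ {isPartition (shape rs)} t₁ (T∧ {all strictlyIncreasing rs} t₂
    (T∧ {columnsIncrease rs} t₃ (Ent⇒T (length s) (concat rs) (Tab-Ent t))))

ClBelow : ℕ → Label → Set
ClBelow h (op _) = ⊤
ClBelow h (cl r) = r < h

Ins-height : ∀ {v i rs rs′} → Ins v i rs rs′ →
             i < length rs′ × length rs ≤ length rs′ × (∀ {h} → i < h → length rs ≤ h → length rs′ ≤ h)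
Ins-height new  = s≤s z≤n , z≤n , λ p _ → p
Ins-height here = s≤s z≤n , ≤-refl , λ _ p → p
Ins-height (there I) with p , q , f ← Ins-height I =
  s≤s p , s≤s q , λ { (s≤s a) (s≤s b) → s≤s (f a b) }

Tab-height : ∀ {rs s h} → Tab rs s → length rs ≤ h → All (ClBelow h) s
Tab-height []          p = []
Tab-height (add t I _) p with q , r , _ ← Ins-height I = ≤-trans q p ∷ Tab-height t (≤-trans r p)

Tab-height⁻ : ∀ {rs s h} → Tab rs s → All (ClBelow h) s → length rs ≤ h
Tab-height⁻ []          []      = z≤n
Tab-height⁻ (add t I _) (p ∷ a) = proj₂ (proj₂ (Ins-height I)) p (Tab-height⁻ t a)

-- Columns of odd length

odd# : (ℕ → ℕ) → ℕ → ℕ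
odd# f n = length (filter (λ j → isOdd (f j) Data.Bool.≟ true) (upTo n))

bit : Bool → ℕ
bit true  = 1
bit false = 0

odd#-suc : ∀ f n → odd# f (suc n) ≡ bit (isOdd (f n)) + odd# f n
odd#-suc f n = trans (cong (λ l → length (filter P l)) (sym (upTo-∷ʳ n)))
  (trans (cong length (filter-++ P (upTo n) (n ∷ [])))
  (trans (length-++ (filter P (upTo n)))
  (trans (+-comm (odd# f n) _) (cong (_+ odd# f n) last))))
  where
  P = λ j → isOdd (f j) Data.Bool.≟ true
  last : length (filter P (n ∷ [])) ≡ bit (isOdd (f n))
  last with isOdd (f n)
  ... | true  = refl
  ... | false = refl

odd#-cong : ∀ f g n → (∀ j → j < n → isOdd (f j) ≡ isOdd (g j)) → odd# f n ≡ odd# g n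
odd#-cong f g zero    e = refl
odd#-cong f g (suc n) e = trans (odd#-suc f n) (trans
  (cong₂ _+_ (cong bit (e n ≤-refl)) (odd#-cong f g n (λ j p → e j (m<n⇒m<1+n p)))) (sym (odd#-suc g n)))

odd#-const : ∀ f {m n} b → m ≤ n → (∀ j → m ≤ j → j < n → isOdd (f j) ≡ b) → odd# f n ≡ (n ∸ m) * bit b + odd# f m
odd#-const f {zero}  {zero}  b p h = refl
odd#-const f {m} {suc n} b p h with m ≟ suc n
... | yes refl = cong (λ z → z * bit b + odd# f m) (sym (n∸n≡0 n))
... | no  q    = trans (odd#-suc f n) (trans (cong₂ _+_ (cong bit (h n m≤n ≤-refl))
    (odd#-const f b m≤n (λ j r s → h j r (m<n⇒m<1+n s))))
    (trans (sym (+-assoc (bit b) _ _)) (cong (λ z → z * bit b + odd# f m) (sym (+-∸-assoc 1 m≤n)))))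
  where m≤n = ≤-pred (≤∧≢⇒< p q)

alt-front : ∀ J f → alt (suc J) f ≡ (f 0 ∸ f 1) + alt J (λ d → f (suc (suc d)))
alt-front zero    f = refl
alt-front (suc J) f = trans (cong (f (dbl (suc J)) ∸ f (suc (dbl (suc J))) +_) (alt-front J f)) (+-swap (f (dbl (suc J)) ∸ f (suc (dbl (suc J)))) (f 0 ∸ f 1) _)

alt-zero : ∀ J → alt J (λ _ → 0) ≡ 0
alt-zero zero    = refl
alt-zero (suc J) = alt-zero J

firstRow-beyond : ∀ {b xs} → Desc b xs → ∀ j → firstRow xs ≤ j → col xs j ≡ 0
firstRow-beyond []           j p = refl
firstRow-beyond (cons q _ d) j p = col-beyond (cons q ≤-refl d) p

firstRow-≤ : ∀ {b xs} → Desc b xs → firstRow xs ≤ b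
firstRow-≤ []           = z≤n
firstRow-≤ (cons _ p _) = p

-- Two rows are removed at a time: columns beyond the second row have length 1, and the others lose
-- two boxes and keep their parity.
oddColumns≡alt : ∀ J {b} xs → Desc b xs → Bounded J (nth xs) → oddColumns xs ≡ alt J (nth xs)
oddColumns≡alt J       []           d B = sym (alt-zero J)
oddColumns≡alt zero    (x ∷ _)      (cons p _ _) B = ⊥-elim (<⇒≢ p (sym (B 0 z≤n)))
oddColumns≡alt (suc J) (x ∷ [])     (cons p _ d) B = trans
  (odd#-const (col (x ∷ [])) {0} {x} true z≤n (λ j _ q → cong isOdd (col-∷-> {x} {[]} q)))
  (trans (+-identityʳ (x * 1)) (trans (*-identityʳ x) (sym (trans (alt-front J (nth (x ∷ [])))
    (trans (cong (x +_) (alt-zero J)) (+-identityʳ x))))))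
oddColumns≡alt (suc J) (x ∷ y ∷ xs) (cons p _ (cons q r d)) B = trans
  (odd#-const f {y} {x} true r (λ j s t → cong isOdd
    (trans (col-∷-> {x} {y ∷ xs} t) (cong suc (trans (col-∷-≤ {y} {xs} s) (col-beyond d s))))))
  (trans (cong₂ _+_ (*-identityʳ (x ∸ y))
    (trans (odd#-cong f (col xs) y (λ j s → cong isOdd
       (trans (col-∷-> {x} {y ∷ xs} (<-≤-trans s r)) (cong suc (col-∷-> {y} {xs} s)))))
    (trans (odd#-const (col xs) {firstRow xs} {y} false (firstRow-≤ d) (λ j s _ → cong isOdd (firstRow-beyond d j s)))
    (trans (cong (_+ oddColumns xs) (*-zeroʳ (y ∸ firstRow xs)))
    (oddColumns≡alt J xs d (λ e s → B (suc (suc e)) (s≤s (s≤s s))))))))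
  (sym (alt-front J (nth (x ∷ y ∷ xs)))))
  where f = col (x ∷ y ∷ xs)

nth-beyond : ∀ xs d → length xs ≤ d → nth xs d ≡ 0
nth-beyond []       d       p       = refl
nth-beyond (x ∷ xs) (suc d) (s≤s p) = nth-beyond xs d p

n≤dbl : ∀ n → n ≤ dbl n
n≤dbl zero    = z≤n
n≤dbl (suc n) = s≤s (m≤n⇒m≤1+n (n≤dbl n))

Bounded-nth : ∀ xs → Bounded (length xs) (nth xs)
Bounded-nth xs d p = nth-beyond xs d (≤-trans (n≤dbl (length xs)) p)

-- Longest increasing subsequences under insertion

data Inc : ℕ → ℕ → List ℕ → Set where
  stop : ∀ {q xs} → Inc q 0 xs
  skip : ∀ {q L x xs} → Inc q L xs → Inc q L (x ∷ xs)
  take : ∀ {q L x xs} → q ≤ x → Inc (suc x) L xs → Inc q (suc L) (x ∷ xs)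

Inc-cong : ∀ {q L L′ xs} → L ≡ L′ → Inc q L xs → Inc q L′ xs
Inc-cong refl i = i

Inc-lower : ∀ {q q′ L xs} → q′ ≤ q → Inc q L xs → Inc q′ L xs
Inc-lower p stop       = stop
Inc-lower p (skip i)   = skip (Inc-lower p i)
Inc-lower p (take q i) = take (≤-trans p q) i

Inc-shorten : ∀ {q L L′ xs} → L′ ≤ L → Inc q L xs → Inc q L′ xs
Inc-shorten z≤n     _          = stop
Inc-shorten (s≤s p) (skip i)   = skip (Inc-shorten (s≤s p) i)
Inc-shorten (s≤s p) (take q i) = take q (Inc-shorten p i)

Inc-tail : ∀ {q L xs} → Inc q (suc L) xs → Inc (suc q) L xs
Inc-tail (skip i)   = skip (Inc-tail i)
Inc-tail (take q i) = skip (Inc-lower (s≤s q) i)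

Inc-raise : ∀ {q b L xs} → All (λ x → x < q ⊎ b ≤ x) xs → Inc q L xs → Inc b L xs
Inc-raise a              stop       = stop
Inc-raise (_ ∷ a)        (skip i)   = skip (Inc-raise a i)
Inc-raise (inj₁ r ∷ a)   (take p i) = ⊥-elim (<⇒≱ r p)
Inc-raise (inj₂ r ∷ a)   (take p i) = take r i

-- In Carry b the first b becomes b + 1, the first b + 1 after it becomes b + 2, and so on.
data Carry : ℕ → List ℕ → List ℕ → Set where
  []  : ∀ {b} → Carry b [] []
  eq  : ∀ {b l l′} → Carry (suc b) l l′ → Carry b (b ∷ l) (suc b ∷ l′)
  ne  : ∀ {b x l l′} → x ≢ b → Carry b l l′ → Carry b (x ∷ l) (x ∷ l′)

-- A subsequence that passes over the first `b` gives up its first letter for the raised letter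
-- `suc b`; the rest then moves on with the carry from `suc b`.
Carry-suc : ∀ {b l l′ L} → Carry b l l′ → Inc b L l → Inc (suc b) L l′
Carry-Inc : ∀ {b l l′ q L} → Carry b l l′ → Inc q L l → Inc q L l′
Carry-suc c        stop       = stop
Carry-suc {L = zero}  (eq c)   i          = stop
Carry-suc {L = suc L} (eq c)   (skip i)   = take ≤-refl (Carry-suc c (Inc-tail i))
Carry-suc (eq c)   (take p i) = take ≤-refl (Carry-suc c i)
Carry-suc (ne n c) (skip i)   = skip (Carry-suc c i)
Carry-suc (ne n c) (take p i) = take (≤∧≢⇒< p (λ e → n (sym e))) (Carry-Inc c i)
Carry-Inc c        stop       = stop
Carry-Inc (eq c)   (skip i)   = skip (Carry-Inc c i)
Carry-Inc (eq c)   (take p i) = take (m≤n⇒m≤1+n p) (Carry-suc c i)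
Carry-Inc (ne n c) (skip i)   = skip (Carry-Inc c i)
Carry-Inc (ne n c) (take p i) = take p (Carry-Inc c i)

Carry-suc⁻ : ∀ {b l l′ L} → Carry b l l′ → Inc (suc b) L l′ → Inc b L l
-- A subsequence of the new word that misses the start of the carry can be replaced by one
-- through the letters b, b + 1, … that were carried.
Carry-Inc⁻ : ∀ {b l l′ q L} → Carry b l l′ → Inc q L l′ → Inc q L l ⊎ (b < q × Inc b (L + (q ∸ suc b)) l)
Carry-suc⁻ c        stop       = stop
Carry-suc⁻ {L = zero}  (eq c)   i          = stop
Carry-suc⁻ {L = suc L} (eq c)   (skip i)   = take ≤-refl (Carry-suc⁻ c (Inc-tail i))
Carry-suc⁻ (eq c)   (take p i) = take ≤-refl (Carry-suc⁻ c (Inc-lower (s≤s p) i))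
Carry-suc⁻ (ne n c) (skip i)   = skip (Carry-suc⁻ c i)
Carry-suc⁻ {b} {L = suc L} (ne {x = x} n c) (take p i) with Carry-Inc⁻ c i
... | inj₁ j       = take (<⇒≤ p) j
-- As `x` exceeds `b`, the replacement through the carried letters is longer by at least one, which
-- makes up for `x`.
... | inj₂ (_ , j) = skip (Inc-shorten (subst (_≤ L + (x ∸ b)) (+-comm L 1) (+-monoʳ-≤ L (m<n⇒0<n∸m p))) j)
Carry-Inc⁻ c        stop       = inj₁ stop
Carry-Inc⁻ {b} {q = q} {L} (eq c) (skip i) with Carry-Inc⁻ c i
... | inj₁ j       = inj₁ (skip j)
... | inj₂ (p , j) = inj₂ (<-trans (n<1+n b) p , Inc-cong
                       (trans (sym (+-suc L _)) (cong (L +_) (sym (+-∸-assoc 1 p)))) (take ≤-refl j))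
Carry-Inc⁻ {b} {q = q} {suc L} (eq c) (take p i) with q ≤? b
... | yes r = inj₁ (take r (Carry-suc⁻ c i))
... | no  r = inj₂ (≰⇒> r , Inc-cong
                (cong suc (trans (sym (+-identityʳ L)) (cong (L +_) (sym (m≤n⇒m∸n≡0 p)))))
                (take ≤-refl (Carry-suc⁻ c i)))
Carry-Inc⁻ (ne n c) (skip i) with Carry-Inc⁻ c i
... | inj₁ j       = inj₁ (skip j)
... | inj₂ (p , j) = inj₂ (p , skip j)
Carry-Inc⁻ {b} {q = q} {suc L} (ne {x = x} n c) (take p i) with Carry-Inc⁻ c i
... | inj₁ j       = inj₁ (take p j)
... | inj₂ (r , j) with q ≤? b
...   | yes t = inj₁ (skip (Inc-lower t (Inc-shorten
                  (subst (_≤ L + (x ∸ b)) (+-comm L 1)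
                    (+-monoʳ-≤ L (m<n⇒0<n∸m (≤∧≢⇒< (≤-pred r) (λ e → n (sym e)))))) j)))
...   | no  t = inj₂ (≰⇒> t , skip (Inc-shorten
                  (subst (_≤ L + (x ∸ b)) (trans (cong (L +_) (+-∸-assoc 1 (≰⇒> t))) (+-suc L _))
                    (+-monoʳ-≤ L (∸-monoˡ-≤ b p))) j))

-- The letter p jumps to b and starts a carry; no letter lies between p and b.
data Shift (p b : ℕ) : List ℕ → List ℕ → Set where
  pass : ∀ {x l l′} → x < p ⊎ b ≤ x → Shift p b l l′ → Shift p b (x ∷ l) (x ∷ l′)
  jump : ∀ {l l′} → All (λ x → x < suc p ⊎ b ≤ x) l → Carry b l l′ → Shift p b (p ∷ l) (b ∷ l′)

Shift-Inc : ∀ {p b l l′ q L} → p < b → Shift p b l l′ → Inc q L l → Inc q L l′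
Shift-Inc pb s          stop       = stop
Shift-Inc pb (pass _ s) (skip i)   = skip (Shift-Inc pb s i)
Shift-Inc pb (pass _ s) (take p i) = take p (Shift-Inc pb s i)
Shift-Inc pb (jump a c) (skip i)   = skip (Carry-Inc c i)
Shift-Inc pb (jump a c) (take p i) = take (≤-trans p (<⇒≤ pb)) (Carry-suc c (Inc-raise a i))

-- In the second alternative the subsequence is rerouted through `p` and the letters carried after
-- it, which gains `q ∸ b` letters. Each earlier letter raises the bound `q` by at least one, so the
-- gain pays for bypassing it. The condition on `q` keeps the bound out of the gap between `p` and
-- `b`.
Shift-Inc⁻′ : ∀ {p b l l′ q L} → p < b → q ≤ p ⊎ b < q → Shift p b l l′ → Inc q L l′ →
              Inc q L l ⊎ (b < q × Inc p (L + (q ∸ b)) l)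
Shift-Inc⁻′ pb h s stop = inj₁ stop
Shift-Inc⁻′ pb h (pass _ s) (skip i) with Shift-Inc⁻′ pb h s i
... | inj₁ j       = inj₁ (skip j)
... | inj₂ (r , j) = inj₂ (r , skip j)
Shift-Inc⁻′ {p} {b} {q = q} {suc L} pb h (pass {x} t s) (take u i) with Shift-Inc⁻′ pb (Sum.map (λ z → z) s≤s t) s i
... | inj₁ j       = inj₁ (take u j)
... | inj₂ (r , j) with h
...   | inj₁ v = inj₁ (skip (Inc-lower v (Inc-shorten
                   (subst (_≤ L + (suc x ∸ b)) (+-comm L 1) (+-monoʳ-≤ L (m<n⇒0<n∸m r))) j)))
...   | inj₂ v = inj₂ (v , skip (Inc-shorten
                   (subst (_≤ L + (suc x ∸ b)) (trans (cong (L +_) (+-∸-assoc 1 (<⇒≤ v))) (+-suc L _))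
                     (+-monoʳ-≤ L (∸-monoˡ-≤ b (s≤s u)))) j))
Shift-Inc⁻′ {L = L} pb h (jump a c) (skip i) with Carry-Inc⁻ c i
... | inj₁ j       = inj₁ (skip j)
... | inj₂ (r , j) = inj₂ (r , Inc-cong
                       (trans (sym (+-suc L _)) (cong (L +_) (sym (+-∸-assoc 1 r)))) (take ≤-refl (Inc-lower pb j)))
Shift-Inc⁻′ pb (inj₁ v) (jump a c) (take u i) = inj₁ (take v (Inc-lower pb (Carry-suc⁻ c i)))
Shift-Inc⁻′ pb (inj₂ v) (jump a c) (take u i) = ⊥-elim (<⇒≱ v u)

Shift-Inc⁻ : ∀ {p b l l′ L} → p < b → Shift p b l l′ → Inc 0 L l′ → Inc 0 L l
Shift-Inc⁻ pb s i with Shift-Inc⁻′ pb (inj₁ z≤n) s i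
... | inj₁ j = j

-- Growth diagrams of an involution

-- The position of the ejected letter, hence the partner of the step in the involution.
hitPos : ∀ {c ρ s s′} → Bump c ρ s s′ → ℕ
hitPos (hit {s})  = length s
hitPos (op≡ b)    = hitPos b
hitPos (op≢ _ b)  = hitPos b
hitPos (cl≡ b)    = hitPos b
hitPos (cl≢ _ b)  = hitPos b

hitPos-< : ∀ {c ρ s s′} (b : Bump c ρ s s′) → hitPos b < length s
hitPos-< hit       = ≤-refl
hitPos-< (op≡ b)   = m<n⇒m<1+n (hitPos-< b)
hitPos-< (op≢ _ b) = m<n⇒m<1+n (hitPos-< b)
hitPos-< (cl≡ b)   = m<n⇒m<1+n (hitPos-< b)
hitPos-< (cl≢ _ b) = m<n⇒m<1+n (hitPos-< b)

-- Here `σ` is only constrained. The partner of an open letter lies in the future, so `σ` itself is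
-- built later, from the last step backwards.
Cons : (ℕ → ℕ) → ∀ {l s} → Run l s → Set
Cons σ start                 = ⊤
Cons σ (up {s = s} r _ _)    = Cons σ r × length s < σ (length s)
Cons σ (down {s = s} r _ _ b) = Cons σ r × σ (hitPos b) ≡ length s × σ (length s) ≡ hitPos b

ConsF : (ℕ → ℕ) → ∀ {m s q} → ℕ → Flush m s q → Set
ConsF σ y done          = ⊤
ConsF σ y (b ∷⟨ _ ⟩ fl) = (σ (hitPos b) ≡ y × σ y ≡ hitPos b) × ConsF σ (suc y) fl

code : Label → ℕ
code (op _) = 0
code (cl r) = suc r

-- Fomin's local rule on edge labels, `h` being the label that crosses the cell: a marked cell
-- starts in row 0, two equal rows are pushed to the next row, and otherwise `h` passes unchanged.
nxt : Bool → ℕ → ℕ → ℕ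
nxt true  h       v = 1
nxt false zero    v = 0
nxt false (suc h) v = if suc h ≡ᵇ v then suc (suc h) else suc h

≡ᵇ-true : ∀ {x y} → x ≡ y → (x ≡ᵇ y) ≡ true
≡ᵇ-true {zero}  refl = refl
≡ᵇ-true {suc x} refl = ≡ᵇ-true {x} refl

≡ᵇ-false : ∀ {x y} → x ≢ y → (x ≡ᵇ y) ≡ false
≡ᵇ-false {zero}  {zero}  n = ⊥-elim (n refl)
≡ᵇ-false {zero}  {suc y} n = refl
≡ᵇ-false {suc x} {zero}  n = refl
≡ᵇ-false {suc x} {suc y} n = ≡ᵇ-false (λ e → n (cong suc e))

nxt-0 : ∀ v → nxt false v 0 ≡ v
nxt-0 zero    = refl
nxt-0 (suc v) = refl

nxt-≡ : ∀ r → nxt false (suc r) (suc r) ≡ suc (suc r)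
nxt-≡ r = cong (λ z → if z then suc (suc r) else suc r) (≡ᵇ-true {r} refl)

nxt-≢ : ∀ h v → h ≢ v → nxt false h v ≡ h
nxt-≢ zero    v n = refl
nxt-≢ (suc h) v n = cong (λ z → if z then suc (suc h) else suc h) (≡ᵇ-false n)

nxt-pos : ∀ b h v → 0 < h → 0 < nxt b h v
nxt-pos true  h       v p = s≤s z≤n
nxt-pos false (suc h) v p with suc h ≡ᵇ v
... | true  = s≤s z≤n
... | false = s≤s z≤n

module Grid (σ : ℕ → ℕ) (σσ : ∀ x → σ (σ x) ≡ x) where

  σ-flip : ∀ {x y} → σ x ≡ y → σ y ≡ x
  σ-flip {x} refl = σσ x

  -- A growth diagram by its edge labels: H x y on the horizontal edge of column x at height y,
  -- V x y on the vertical edge of row y at abscissa x; 0 is no box, suc r is a box in row r.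
  H V : ℕ → ℕ → ℕ
  H x zero    = 0
  H x (suc y) = nxt (σ x ≡ᵇ y) (H x y) (V x y)
  V zero    y = 0
  V (suc x) y = nxt (σ x ≡ᵇ y) (V x y) (H x y)

  -- The local rule treats both directions alike, and the marked cells of an involution are
  -- symmetric about the diagonal.
  V≡H : ∀ x y → V x y ≡ H y x
  V≡H zero    y = refl
  V≡H (suc x) y rewrite V≡H x y | V≡H y x = cong (λ z → nxt z (H y x) (H x y)) flip≡
    where
    flip≡ : (σ x ≡ᵇ y) ≡ (σ y ≡ᵇ x)
    flip≡ with σ x ≟ y
    ... | yes e = trans (≡ᵇ-true e) (sym (≡ᵇ-true (σ-flip e)))
    ... | no  n = trans (≡ᵇ-false n) (sym (≡ᵇ-false (λ e → n (σ-flip e))))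

  cell : ∀ x y b → (σ x ≡ᵇ y) ≡ b → H x (suc y) ≡ nxt b (H x y) (V x y) × V (suc x) y ≡ nxt b (V x y) (H x y)
  cell x y b refl = refl , refl

  cell-X : ∀ {x y} → σ x ≡ y → H x (suc y) ≡ 1 × V (suc x) y ≡ 1
  cell-X {x} {y} e = cell x y true (≡ᵇ-true e)

  cell-H0 : ∀ {x y} → σ x ≢ y → H x y ≡ 0 → H x (suc y) ≡ 0 × V (suc x) y ≡ V x y
  cell-H0 {x} {y} n e with cell x y false (≡ᵇ-false n)
  ... | p , q = trans p (cong (λ z → nxt false z (V x y)) e) ,
                trans q (trans (cong (nxt false (V x y)) e) (nxt-0 (V x y)))

  cell-V0 : ∀ {x y} → σ x ≢ y → V x y ≡ 0 → H x (suc y) ≡ H x y × V (suc x) y ≡ 0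
  cell-V0 {x} {y} n e with cell x y false (≡ᵇ-false n)
  ... | p , q = trans p (trans (cong (nxt false (H x y)) e) (nxt-0 (H x y))) ,
                trans q (cong (λ z → nxt false z (H x y)) e)

  cell-≡ : ∀ {x y r} → σ x ≢ y → H x y ≡ suc r → V x y ≡ suc r → H x (suc y) ≡ 2 + r × V (suc x) y ≡ 2 + r
  cell-≡ {x} {y} {r} n e e′ with cell x y false (≡ᵇ-false n)
  ... | p , q = trans p (trans (cong₂ (nxt false) e e′) (nxt-≡ r)) ,
                trans q (trans (cong₂ (nxt false) e′ e) (nxt-≡ r))

  cell-≢ : ∀ {x y} → σ x ≢ y → H x y ≢ V x y → H x (suc y) ≡ H x y × V (suc x) y ≡ V x y
  cell-≢ {x} {y} n d with cell x y false (≡ᵇ-false n)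
  ... | p , q = trans p (nxt-≢ (H x y) (V x y) d) , trans q (nxt-≢ (V x y) (H x y) (λ e → d (sym e)))

  H-zero : ∀ x y → y ≤ σ x → H x y ≡ 0
  H-zero x zero    p = refl
  H-zero x (suc y) p = proj₁ (cell-H0 (λ e → <⇒≢ p (sym e)) (H-zero x y (<⇒≤ p)))

  V-zero : ∀ x y → x ≤ σ y → V x y ≡ 0
  V-zero x y p = trans (V≡H x y) (H-zero y x p)

  H-pos : ∀ x y → σ x < y → 0 < H x y
  H-pos x (suc y) p with σ x ≟ y
  ... | yes e = subst (0 <_) (sym (proj₁ (cell-X e))) (s≤s z≤n)
  ... | no  n = nxt-pos (σ x ≡ᵇ y) (H x y) (V x y) (H-pos x y (≤∧≢⇒< (≤-pred p) n))

  Agree : ℕ → State → Set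
  Agree y []      = ⊤
  Agree y (l ∷ s) = code l ≡ H (length s) y × Agree y s

  Agree-idle : ∀ {y} s → length s ≤ σ y → Agree y s → Agree (suc y) s
  Agree-idle {y} []      p a       = tt
  Agree-idle {y} (l ∷ s) p (e , a) =
    trans e (sym (proj₁ (cell-V0 (λ q → <⇒≢ p (sym (σ-flip q))) (V-zero (length s) y (<⇒≤ p))))) ,
    Agree-idle s (<⇒≤ p) a

  off-hit : ∀ {c ρ s s′ y} (b : Bump c ρ s s′) → σ (hitPos b) ≡ y → σ (length s) ≢ y
  off-hit {s = s} b e q = <⇒≢ (hitPos-< b) (trans (sym (σ-flip e)) (σ-flip q))

  -- The constructors of `Bump` are the cells of row `y`. Left of the ejected letter nothing
  -- happens, `hit` is the marked cell, and to its right the vertical label is the row that the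
  -- insertion has reached.
  Agree-bump : ∀ {c ρ s s′ y} (b : Bump c ρ s s′) → σ (hitPos b) ≡ y → Agree y s →
               Agree (suc y) s′ × V (length s) y ≡ suc ρ
  Agree-bump {y = y} (hit {s}) e (_ , a) =
    (sym (proj₁ (cell-X e)) , Agree-idle s (≤-reflexive (sym (σ-flip e))) a) , proj₂ (cell-X e)
  Agree-bump (op≡ b) e (h , a) with a′ , v ← Agree-bump b e a with p , q ← cell-H0 (off-hit b e) (sym h)
    rewrite Bump-length b = (sym p , a′) , trans q v
  Agree-bump (op≢ _ b) e (h , a) with a′ , v ← Agree-bump b e a with p , q ← cell-H0 (off-hit b e) (sym h)
    rewrite Bump-length b = (sym p , a′) , trans q v
  Agree-bump (cl≡ b) e (h , a) with a′ , v ← Agree-bump b e a with p , q ← cell-≡ (off-hit b e) (sym h) v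
    rewrite Bump-length b = (sym p , a′) , q
  Agree-bump (cl≢ n b) e (h , a) with a′ , v ← Agree-bump b e a
    with p , q ← cell-≢ (off-hit b e) (λ x → n (suc-injective (trans h (trans x v))))
    rewrite Bump-length b = (trans h (sym p) , a′) , trans q v

  Agree-run : ∀ {l s} (r : Run l s) → Cons σ r → Agree (length s) s
  Agree-run start c = tt
  Agree-run (up {s = s} r _ _) (c , p) =
    sym (H-zero (length s) (suc (length s)) p) , Agree-idle s (<⇒≤ p) (Agree-run r c)
  Agree-run (down {ρ = ρ} {s = s} {s′} r _ _ b) (c , e , e′) with a , v ← Agree-bump b e (Agree-run r c)
    -- In the diagonal cell both incoming labels agree by symmetry, so the local rule passes to the
    -- next row. This is where `cl (suc ρ)` comes from.
    with p , _ ← cell-≡ (off-hit b e) (trans (sym (V≡H (length s) (length s))) v) v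
    rewrite Bump-length b = sym p , a

  Agree-flush : ∀ {m s q y} (fl : Flush m s q) → ConsF σ y fl → Agree y s → Agree (m + y) q
  Agree-flush done c a = a
  Agree-flush {suc m} {q = q} {y} (b ∷⟨ _ ⟩ fl) ((e , _) , c) a =
    subst (λ n → Agree n q) (+-suc m y) (Agree-flush fl c (proj₁ (Agree-bump b e a)))

-- Lines of the grid as words: decreasing subsequences and nested arcs

seg : (ℕ → ℕ) → ℕ → ℕ → List ℕ
seg f x zero    = []
seg f x (suc k) = f x ∷ seg f (suc x) k

seg-cong : ∀ {f g} x k → (∀ z → z < x + k → f z ≡ g z) → seg f x k ≡ seg g x k
seg-cong x zero    e = refl
seg-cong x (suc k) e =
  cong₂ _∷_ (e x (m<m+n x (s≤s z≤n))) (seg-cong (suc x) k (λ z p → e z (subst (z <_) (sym (+-suc x k)) p)))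

seg-∷ʳ : ∀ f x k xs → seg f x (suc k) ++ xs ≡ seg f x k ++ f (x + k) ∷ xs
seg-∷ʳ f x zero    xs = cong (λ z → f z ∷ xs) (sym (+-identityʳ x))
seg-∷ʳ f x (suc k) xs = cong (f x ∷_) (trans (seg-∷ʳ f (suc x) k xs)
  (cong (λ z → seg f (suc x) k ++ f z ∷ xs) (sym (+-suc x k))))

seg-skip : ∀ f x k {q L xs} → Inc q L xs → Inc q L (seg f x k ++ xs)
seg-skip f x zero    i = i
seg-skip f x (suc k) i = skip (seg-skip f (suc x) k i)

module Rows (σ : ℕ → ℕ) (σσ : ∀ x → σ (σ x) ≡ x) (n N : ℕ) (n≤N : n ≤ N)
            (σ<N : ∀ x → x < N → σ x < N) where

  open Grid σ σσ

  -- The word of row y: the boxes already placed, preceded in value by the columns still to come,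
  -- the later ones being the smaller.
  letter : ℕ → ℕ → ℕ
  letter y x = if σ x <ᵇ y then N + H x y else N ∸ suc (σ x)

  letter-old : ∀ {x y} → σ x < y → letter y x ≡ N + H x y
  letter-old {x} {y} p with σ x <ᵇ y | <⇒<ᵇ p
  ... | true | _ = refl

  letter-new : ∀ {x y} → y ≤ σ x → letter y x ≡ N ∸ suc (σ x)
  letter-new {x} {y} p with σ x <ᵇ y in e
  ... | false = refl
  ... | true  = ⊥-elim (<⇒≱ (<ᵇ⇒< (σ x) y (subst T (sym e) tt)) p)

  private
    letter-pass : ∀ {x y} → x < N → σ x ≢ y → H x (suc y) ≡ H x y → letter (suc y) x ≡ letter y x
    letter-pass {x} {y} _ n e with <-cmp (σ x) y
    ... | tri< p _ _ = trans (letter-old (m<n⇒m<1+n p)) (trans (cong (N +_) e) (sym (letter-old p)))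
    ... | tri≈ _ p _ = ⊥-elim (n p)
    ... | tri> _ _ p = trans (letter-new p) (sym (letter-new (<⇒≤ p)))

    letter-gap : ∀ {x y} → x < N → σ x ≢ y → letter y x < N ∸ suc y ⊎ N + 1 ≤ letter y x
    letter-gap {x} {y} l n with <-cmp (σ x) y
    ... | tri< p _ _ = inj₂ (subst (N + 1 ≤_) (sym (letter-old p)) (+-monoʳ-≤ N (H-pos x y p)))
    ... | tri≈ _ p _ = ⊥-elim (n p)
    ... | tri> _ _ p = inj₁ (subst (_< N ∸ suc y) (sym (letter-new (<⇒≤ p))) (∸-monoʳ-< (s≤s p) (σ<N x l)))

  -- Right of the marked cell the vertical label and the letter being carried are the same thing.
  -- The second component is the gap in the values that `jump` asks for.
  row-carry : ∀ y a r x k → σ a ≡ y → a < x → x + k ≤ N → V x y ≡ suc r →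
              Carry (N + suc r) (seg (letter y) x k) (seg (letter (suc y)) x k) ×
              All (λ z → z < suc (N ∸ suc y) ⊎ N + 1 ≤ z) (seg (letter y) x k)
  row-carry y a r x zero    e p q v = [] , []
  row-carry y a r x (suc k) e p q v = step (<-cmp (σ x) y)
    where
    x<N : x < N
    x<N = ≤-trans (m<m+n x (s≤s z≤n)) q
    n≢ : σ x ≢ y
    n≢ z = <⇒≢ p (trans (sym (σ-flip e)) (σ-flip z))
    gap : letter y x < suc (N ∸ suc y) ⊎ N + 1 ≤ letter y x
    gap with letter-gap x<N n≢
    ... | inj₁ z = inj₁ (m<n⇒m<1+n z)
    ... | inj₂ z = inj₂ z
    same : letter y x ≢ N + suc r → H x (suc y) ≡ H x y → V (suc x) y ≡ suc r →
           Carry (N + suc r) (seg (letter y) x (suc k)) (seg (letter (suc y)) x (suc k)) ×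
           All (λ z → z < suc (N ∸ suc y) ⊎ N + 1 ≤ z) (seg (letter y) x (suc k))
    same d h w with c , a′ ← row-carry y a r (suc x) k e (m<n⇒m<1+n p) (subst (_≤ N) (+-suc x k) q) w =
      subst (λ z → Carry (N + suc r) (letter y x ∷ seg (letter y) (suc x) k) (z ∷ seg (letter (suc y)) (suc x) k))
        (sym (letter-pass x<N n≢ h)) (ne d c) , gap ∷ a′
    step : _ → Carry (N + suc r) (seg (letter y) x (suc k)) (seg (letter (suc y)) x (suc k)) ×
               All (λ z → z < suc (N ∸ suc y) ⊎ N + 1 ≤ z) (seg (letter y) x (suc k))
    step (tri≈ _ z _) = ⊥-elim (n≢ z)
    step (tri> _ _ z) =
      same (λ d → <⇒≢ (<-≤-trans (∸-monoʳ-< {N} (s≤s z≤n) (σ<N x x<N)) (m≤m+n N (suc r)))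
             (trans (sym (letter-new (<⇒≤ z))) d))
           (trans (proj₁ hv) (sym h0)) (trans (proj₂ hv) v)
      where
      h0 = H-zero x y (<⇒≤ z)
      hv = cell-H0 n≢ h0
    step (tri< z _ _) with H x y ≟ suc r
    ... | no  d = same (λ t → d (+-cancelˡ-≡ N _ _ (trans (sym (letter-old z)) t))) (proj₁ hv) (trans (proj₂ hv) v)
      where hv = cell-≢ n≢ (λ t → d (trans t v))
    ... | yes d with hv₁ , hv₂ ← cell-≡ n≢ d v
      with c , a′ ← row-carry y a (suc r) (suc x) k e (m<n⇒m<1+n p) (subst (_≤ N) (+-suc x k) q) hv₂ =
      subst₂ (λ z z′ → Carry (N + suc r) (z ∷ seg (letter y) (suc x) k) (z′ ∷ seg (letter (suc y)) (suc x) k))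
        (sym (trans (letter-old z) (cong (N +_) d)))
        (sym (trans (letter-old (m<n⇒m<1+n z)) (trans (cong (N +_) hv₁) (+-suc N (suc r)))))
        (eq (subst (λ m → Carry m (seg (letter y) (suc x) k) (seg (letter (suc y)) (suc x) k)) (+-suc N (suc r)) c)) , gap ∷ a′

  -- Column `σ y` turns from a column still to come into a placed one. Its letter was the largest of
  -- those to come, so it jumps across the gap, to the letter `N + 1` of the top row.
  row-shift : ∀ y a x k → σ a ≡ y → x ≤ a → a < x + k → x + k ≤ N →
              Shift (N ∸ suc y) (N + 1) (seg (letter y) x k) (seg (letter (suc y)) x k)
  row-shift y a x zero    e p q t = ⊥-elim (<⇒≱ q (subst (_≤ a) (sym (+-identityʳ x)) p))
  row-shift y a x (suc k) e p q t with x ≟ a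
  ... | yes refl with _ , v ← cell-X e with c , g ← row-carry y a 0 (suc a) k e ≤-refl (subst (_≤ N) (+-suc a k) t) v =
    subst₂ (λ z z′ → Shift (N ∸ suc y) (N + 1) (z ∷ seg (letter y) (suc a) k) (z′ ∷ seg (letter (suc y)) (suc a) k))
      (sym (trans (letter-new (≤-reflexive (sym e))) (cong (λ m → N ∸ suc m) e)))
      (sym (trans (letter-old (s≤s (≤-reflexive e))) (cong (N +_) (proj₁ (cell-X e)))))
      (jump g c)
  ... | no d =
    subst (λ z → Shift (N ∸ suc y) (N + 1) (letter y x ∷ seg (letter y) (suc x) k) (z ∷ seg (letter (suc y)) (suc x) k))
      (sym (letter-pass x<N n≢ (proj₁ (cell-V0 n≢ (V-zero x y (≤-trans p (≤-reflexive (sym (σ-flip e)))))))))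
      (pass (letter-gap x<N n≢) (row-shift y a (suc x) k e (≤∧≢⇒< p d) (subst (a <_) (+-suc x k) q) (subst (_≤ N) (+-suc x k) t)))
    where
    x<N : x < N
    x<N = ≤-trans (m<m+n x (s≤s z≤n)) t
    n≢ : σ x ≢ y
    n≢ z = d (trans (sym (σ-flip z)) (σ-flip e))

  rowWord : ℕ → List ℕ
  rowWord y = seg (letter y) 0 n

  row-step : ∀ {L} y → y < N → (Inc 0 L (rowWord y) → Inc 0 L (rowWord (suc y))) ×
                               (Inc 0 L (rowWord (suc y)) → Inc 0 L (rowWord y))
  row-step {L} y p with σ y <? n
  ... | yes q = Shift-Inc lt s , Shift-Inc⁻ lt s
    where
    s = row-shift y (σ y) 0 n (σσ y) z≤n q n≤N
    lt : N ∸ suc y < N + 1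
    lt = ≤-<-trans (m∸n≤m N (suc y)) (m<m+n N (s≤s z≤n))
  -- The marked cell lies outside the first `n` columns, so all vertical labels met are 0 and no
  -- letter changes.
  ... | no  q = subst (Inc 0 L) same , subst (Inc 0 L) (sym same)
    where
    same : rowWord y ≡ rowWord (suc y)
    same = seg-cong 0 n (λ x r → sym (letter-pass (<-≤-trans r n≤N)
             (λ z → <⇒≱ (subst (_< n) (sym (σ-flip z)) r) (≮⇒≥ q))
             (proj₁ (cell-V0 (λ z → <⇒≱ (subst (_< n) (sym (σ-flip z)) r) (≮⇒≥ q))
               (V-zero x y (≤-trans (<⇒≤ r) (≮⇒≥ q)))))))

  -- This contains Schensted's theorem: at height 0 increasing subsequences of the word are
  -- decreasing ones of `σ`, and at height `N` their greatest length is the number of rows of the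
  -- tableau.
  rows : ∀ {L} y → y ≤ N → (Inc 0 L (rowWord 0) → Inc 0 L (rowWord y)) × (Inc 0 L (rowWord y) → Inc 0 L (rowWord 0))
  rows zero    p = (λ i → i) , (λ i → i)
  rows (suc y) p with f , g ← rows y (<⇒≤ p) | f′ , g′ ← row-step y p = (λ i → f′ (f i)) , (λ i → g (g′ i))

  data Chain : ℕ → ℕ → ℕ → Set where
    stop : ∀ {x v} → Chain x v 0
    step : ∀ {x v L} a → x ≤ a → a < n → σ a < v → Chain (suc a) (σ a) L → Chain x v (suc L)

  Chain-weaken : ∀ {x x′ v v′ L} → x′ ≤ x → v ≤ v′ → Chain x v L → Chain x′ v′ L
  Chain-weaken p q stop             = stop
  Chain-weaken p q (step a r s t c) = step a (≤-trans p r) s (≤-trans t q) c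

  private
    suc-letter : ∀ {a} → σ a < N → suc (N ∸ suc (σ a)) ≡ N ∸ σ a
    suc-letter p = sym (+-∸-assoc 1 p)

  Inc⇒Chain : ∀ {L} x k v → x + k ≡ n → v ≤ N → Inc (N ∸ v) L (seg (letter 0) x k) → Chain x v L
  Inc⇒Chain x zero    v e p stop       = stop
  Inc⇒Chain x (suc k) v e p stop       = stop
  Inc⇒Chain x (suc k) v e p (skip i)   =
    Chain-weaken (n≤1+n x) ≤-refl (Inc⇒Chain (suc x) k v (trans (sym (+-suc x k)) e) p i)
  Inc⇒Chain {suc L} x (suc k) v e p (take q i) =
    step x ≤-refl x<n (∸-cancelʳ-≤ (σ<N x (<-≤-trans x<n n≤N)) q)
      (Inc⇒Chain (suc x) k (σ x) (trans (sym (+-suc x k)) e) (<⇒≤ σx<N)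
        (subst (λ m → Inc m L (seg (letter 0) (suc x) k)) (suc-letter σx<N) i))
    where
    x<n : x < n
    x<n = subst (x <_) e (m<m+n x (s≤s z≤n))
    σx<N = σ<N x (<-≤-trans x<n n≤N)

  Chain⇒Inc : ∀ {L} x k v → x + k ≡ n → Chain x v L → Inc (N ∸ v) L (seg (letter 0) x k)
  Chain⇒Inc x k       v e stop             = stop
  Chain⇒Inc x zero    v e (step a p q r c) =
    ⊥-elim (<⇒≱ q (subst (_≤ a) (trans (sym (+-identityʳ x)) e) p))
  Chain⇒Inc {suc L} x (suc k) v e (step a p q r c) with x ≟ a
  ... | yes refl = take (∸-monoʳ-≤ N r) (subst (λ m → Inc m L (seg (letter 0) (suc x) k))
                     (sym (suc-letter (σ<N x (<-≤-trans q n≤N))))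
                     (Chain⇒Inc (suc x) k (σ x) (trans (sym (+-suc x k)) e) c))
  ... | no  d    = skip (Chain⇒Inc (suc x) k v (trans (sym (+-suc x k)) e) (step a (≤∧≢⇒< p d) q r c))

  -- Nested arcs a — σ a, innermost first.
  data Nest : ℕ → ℕ → ℕ → Set where
    stop : ∀ {x y} → Nest x y 0
    arc  : ∀ {x y L} a → a < x → y ≤ σ a → Nest a (suc (σ a)) L → Nest x y (suc L)

  Nest-weaken : ∀ {x x′ y y′ L} → x ≤ x′ → y′ ≤ y → Nest x y L → Nest x′ y′ L
  Nest-weaken p q stop          = stop
  Nest-weaken p q (arc a r s t) = arc a (<-≤-trans r p) (≤-trans q s) t

  Chain⇒Nest : ∀ {x v L} → Chain x v L → Nest v x L
  Chain⇒Nest stop             = stop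
  Chain⇒Nest (step a p q r c) = arc (σ a) r (subst (_ ≤_) (sym (σσ a)) p)
    (subst (λ z → Nest (σ a) (suc z) _) (sym (σσ a)) (Chain⇒Nest c))

  -- Left ends, read from the outermost arc inwards, have decreasing partners; they are put in front
  -- of the given chain.
  Nest⇒Chainˡ : ∀ {x y L M} → y ≤ N → x ≤ n → Nest x y L → Chain x y M → Chain 0 N (L + M)
  Nest⇒Chainˡ p p′ stop c = Chain-weaken z≤n p c
  Nest⇒Chainˡ {L = suc L} {M} p p′ (arc a q r t) c =
    subst (Chain 0 N) (+-suc L M) (Nest⇒Chainˡ (σ<N a (<-≤-trans a<n n≤N)) (<⇒≤ a<n) t
      (step a ≤-refl a<n ≤-refl (Chain-weaken q r c)))
    where a<n = <-≤-trans q p′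

  module _ (fix-free : ∀ x → x < n → σ x ≢ x) (no-nest : ¬ Nest n n 2) where

    -- Right ends, read from the innermost arc outwards, have decreasing partners too. The outermost
    -- arc is given up, as it may end at `n` or later; by `no-nest` no arc inside it does.
    Nest⇒Chainʳ : ∀ {x y L} → x ≤ n → Nest x y (suc L) → Chain y x L
    Nest⇒Chainʳ p (arc a q r stop) = stop
    Nest⇒Chainʳ p (arc a q r t@(arc a′ q′ r′ t′)) with σ a <? n
    ... | yes s = step (σ a) r s (subst (_< _) (sym (σσ a)) q)
                    (subst (λ z → Chain (suc (σ a)) z _) (sym (σσ a)) (Nest⇒Chainʳ (≤-trans (<⇒≤ q) p) t))
    ... | no  s = ⊥-elim (no-nest (arc a (<-≤-trans q p) (≮⇒≥ s) (arc a′ q′ r′ stop)))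

    Nest⇒Chain : ∀ {i k} → i ≤ n → Nest i i (suc k) → Chain 0 N (suc (k + k))
    Nest⇒Chain p t = Nest⇒Chainˡ (≤-trans p n≤N) p t (Nest⇒Chainʳ p t)

  -- A decreasing subsequence crosses the diagonal; reflecting its longer part gives nested arcs.
  Chain⇒Nest-mid : (∀ x → x < n → σ x ≢ x) → ∀ {x v} j r k → j + r ≡ k → Nest x v j → Chain x v (r + suc k) →
                   ∃ λ i → i ≤ n × Nest i i (suc k)
  Chain⇒Nest-mid ff j zero    k e t (step a p q r c) with <-cmp (σ a) a
  ... | tri≈ _ z _ = ⊥-elim (ff a q z)
  ... | tri< z _ _ = a , <⇒≤ q , arc (σ a) z (≤-reflexive (sym (σσ a)))
                       (subst (λ z → Nest (σ a) (suc z) k) (sym (σσ a)) (Chain⇒Nest c))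
  ... | tri> _ _ z = suc a , q , arc a ≤-refl z
                       (Nest-weaken p r (subst (Nest _ _) (trans (sym (+-identityʳ j)) e) t))
  Chain⇒Nest-mid ff j (suc r) k e t (step a p q s c) =
    Chain⇒Nest-mid ff (suc j) r k (trans (sym (+-suc j r)) e) (arc a ≤-refl ≤-refl (Nest-weaken p s t)) c

  -- Lengths of longest nests, by dynamic programming; f counts the rows y, y + 1, … .
  D : ℕ → ℕ → ℕ → ℕ
  D zero    f       y = 0
  D (suc x) zero    y = 0
  D (suc x) (suc f) y = if σ x ≡ᵇ y then suc (D x f (suc y)) else D x (suc f) y ⊔ D (suc x) f (suc y)

  D-X : ∀ {x f y} → σ x ≡ y → D (suc x) (suc f) y ≡ suc (D x f (suc y))
  D-X {x} {f} {y} e = cong (λ b → if b then suc (D x f (suc y)) else D x (suc f) y ⊔ D (suc x) f (suc y)) (≡ᵇ-true e)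

  D-⊔ : ∀ {x f y} → σ x ≢ y → D (suc x) (suc f) y ≡ D x (suc f) y ⊔ D (suc x) f (suc y)
  D-⊔ {x} {f} {y} e = cong (λ b → if b then suc (D x f (suc y)) else D x (suc f) y ⊔ D (suc x) f (suc y)) (≡ᵇ-false e)

  D-0 : ∀ x y → D x 0 y ≡ 0
  D-0 zero    y = refl
  D-0 (suc x) y = refl

  -- The four bounds depend on each other: where the corner cell holds an arc, monotonicity says
  -- that taking this arc is never worse than leaving it, and that rests on one more row or column
  -- adding at most one arc.
  D-mono-x : ∀ x f y → D x f y ≤ D (suc x) f y
  D-mono-y : ∀ x f y → D x f (suc y) ≤ D x (suc f) y
  D-suc-x  : ∀ x f y → D (suc x) f y ≤ suc (D x f y)
  D-suc-y  : ∀ x f y → D x (suc f) y ≤ suc (D x f (suc y))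
  D-mono-x x zero    y = ≤-reflexive (D-0 x y)
  D-mono-x x (suc f) y with σ x ≟ y
  ... | yes e = subst (D x (suc f) y ≤_) (sym (D-X e)) (D-suc-y x f y)
  ... | no  e = subst (D x (suc f) y ≤_) (sym (D-⊔ e)) (m≤m⊔n _ _)
  D-mono-y zero    f y = z≤n
  D-mono-y (suc x) f y with σ x ≟ y
  ... | yes e = subst (D (suc x) f (suc y) ≤_) (sym (D-X e)) (D-suc-x x f (suc y))
  ... | no  e = subst (D (suc x) f (suc y) ≤_) (sym (D-⊔ e)) (m≤n⊔m _ _)
  D-suc-x x zero    y = z≤n
  D-suc-x x (suc f) y with σ x ≟ y
  ... | yes e = subst (_≤ suc (D x (suc f) y)) (sym (D-X e)) (s≤s (D-mono-y x f y))
  ... | no  e = subst (_≤ suc (D x (suc f) y)) (sym (D-⊔ e))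
                  (⊔-lub (n≤1+n _) (≤-trans (D-suc-x x f (suc y)) (s≤s (D-mono-y x f y))))
  D-suc-y zero    f y = z≤n
  D-suc-y (suc x) f y with σ x ≟ y
  ... | yes e = subst (_≤ suc (D (suc x) f (suc y))) (sym (D-X e)) (s≤s (D-mono-x x f (suc y)))
  ... | no  e = subst (_≤ suc (D (suc x) f (suc y))) (sym (D-⊔ e))
                  (⊔-lub (≤-trans (D-suc-y x f y) (s≤s (D-mono-x x f (suc y)))) (n≤1+n _))

  D-mono : ∀ {x x′ f y} → x ≤ x′ → D x f y ≤ D x′ f y
  D-mono {x} {x′} {f} {y} p = go (≤⇒≤′ p)
    where
    go : ∀ {x′} → x ≤′ x′ → D x f y ≤ D x′ f y
    go ≤′-refl     = ≤-refl
    go (≤′-step p) = ≤-trans (go p) (D-mono-x _ f y)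

  D-mono-rows : ∀ x d f y → D x f (d + y) ≤ D x (d + f) y
  D-mono-rows x zero    f y = ≤-refl
  D-mono-rows x (suc d) f y = ≤-trans (subst (λ z → D x f z ≤ D x (d + f) (suc y)) (+-suc d y) (D-mono-rows x d f (suc y)))
                                (D-mono-y x (d + f) y)

  D⇒Nest : ∀ x f y L → L ≤ D x f y → Nest x y L
  D⇒Nest x       f       y zero    p = stop
  D⇒Nest (suc x) (suc f) y (suc L) p with σ x ≟ y
  ... | yes refl = arc x ≤-refl ≤-refl (D⇒Nest x f (suc y) L (≤-pred (subst (suc L ≤_) (D-X refl) p)))
  ... | no  e with ⊔-sel (D x (suc f) y) (D (suc x) f (suc y))
  ...   | inj₁ z = Nest-weaken (n≤1+n x) ≤-refl (D⇒Nest x (suc f) y (suc L) (subst (suc L ≤_) (trans (D-⊔ e) z) p))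
  ...   | inj₂ z = Nest-weaken ≤-refl (n≤1+n y) (D⇒Nest (suc x) f (suc y) (suc L) (subst (suc L ≤_) (trans (D-⊔ e) z) p))

  Nest⇒D : ∀ {x y L} f → y + f ≡ N → x ≤ n → Nest x y L → L ≤ D x f y
  Nest⇒D f e p stop = z≤n
  Nest⇒D {x} {y} {suc L} f e p (arc a q r t) with g , h ← m≤n⇒∃[o]m+o≡n (σ<N a (<-≤-trans q (≤-trans p n≤N))) =
    ≤-trans (≤-trans (s≤s (Nest⇒D g h (≤-trans (<⇒≤ q) p) t)) (≤-reflexive (sym (D-X refl))))
      (≤-trans (subst₂ (λ z z′ → D (suc a) (suc g) z ≤ D (suc a) z′ y) d≡ f≡ (D-mono-rows (suc a) d (suc g) y))
        (D-mono q))
    where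
    d  = σ a ∸ y
    d≡ : d + y ≡ σ a
    d≡ = m∸n+n≡m r
    f≡ : d + suc g ≡ f
    f≡ = +-cancelˡ-≡ y _ _ (trans (sym (+-assoc y d (suc g))) (trans (cong (_+ suc g) (trans (+-comm y d) d≡))
           (trans (+-suc (σ a) g) (trans h (sym e)))))

  -- For every suffix of the state, the first column of its open letters is as long as the longest
  -- nest of arcs into the `f` rows still to come. Partners of open letters lie ahead, so this is
  -- proved from the last step backwards.
  AgreeD : ℕ → ℕ → State → Set
  AgreeD f y []      = ⊤
  AgreeD f y (l ∷ s) = #op (l ∷ s) 0 ≡ D (suc (length s)) f y × AgreeD f y s

  AgreeD-top : ∀ {f y} s → AgreeD f y s → #op s 0 ≡ D (length s) f y
  AgreeD-top []      _       = refl
  AgreeD-top (l ∷ s) (e , _) = e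

  D-idle : ∀ x f y → x ≤ σ y → D x (suc f) y ≡ D x f (suc y)
  D-idle zero    f y p = refl
  D-idle (suc x) f y p = trans (D-⊔ (λ z → <⇒≢ p (sym (σ-flip z))))
    (trans (cong (_⊔ D (suc x) f (suc y)) (D-idle x f y (<⇒≤ p))) (m≤n⇒m⊔n≡n (D-mono-x x f (suc y))))

  AgreeD-idle : ∀ {f y} s → length s ≤ σ y → AgreeD f (suc y) s → AgreeD (suc f) y s
  AgreeD-idle []      p a       = tt
  AgreeD-idle (l ∷ s) p (e , a) = trans e (sym (D-idle (suc (length s)) _ _ p)) , AgreeD-idle s (<⇒≤ p) a

  -- Each letter is one cell of the recursion for `D`: the maximum compares the first column before
  -- the bump without this letter and the one after the bump with it.
  AgreeD-bump : ∀ {c ρ s s′ f y} (b : Bump c ρ s s′) → σ (hitPos b) ≡ y → AgreeD f (suc y) s′ → AgreeD (suc f) y s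
  AgreeD-bump (hit {s}) e (_ , a) =
    trans (cong suc (AgreeD-top s a)) (sym (D-X e)) , AgreeD-idle s (≤-reflexive (sym (σ-flip e))) a
  AgreeD-bump {s = op (suc c) ∷ s} {op c ∷ s′} {f} {y} (op≡ b) e (h , a) with a′ ← AgreeD-bump b e a =
    trans (sym (⊔-idem (#op s 0))) (trans (cong₂ _⊔_ (AgreeD-top s a′)
      (trans (Bump-#op b 0) (trans h (cong (λ z → D (suc z) f (suc y)) (sym (Bump-length b))))))
      (sym (D-⊔ (off-hit b e)))) , a′
  AgreeD-bump {c} {s = op d ∷ s} {op d ∷ s′} {f} {y} (op≢ n b) e (h , a) with a′ ← AgreeD-bump b e a =
    trans (step≡ d n) (trans (cong₂ _⊔_ (AgreeD-top s a′)
      (trans h (cong (λ z → D (suc z) f (suc y)) (sym (Bump-length b)))))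
      (sym (D-⊔ (off-hit b e)))) , a′
    where
    step≡ : ∀ d → d ≢ c → δ 0 d + #op s 0 ≡ #op s 0 ⊔ (δ 0 d + #op s′ 0)
    step≡ zero    n rewrite +[]-off {#op s} (Bump-#op b) n = sym (m≤n⇒m⊔n≡n (n≤1+n (#op s′ 0)))
    step≡ (suc d) n = sym (m≥n⇒m⊔n≡m (+[]-≤ {#op s} (Bump-#op b) 0))
  AgreeD-bump {s = cl r ∷ s} {cl r′ ∷ s′} {f} {y} (cl≡ b) e (h , a) with a′ ← AgreeD-bump b e a =
    trans (sym (m≥n⇒m⊔n≡m (+[]-≤ {#op s} (Bump-#op b) 0))) (trans (cong₂ _⊔_ (AgreeD-top s a′)
      (trans h (cong (λ z → D (suc z) f (suc y)) (sym (Bump-length b)))))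
      (sym (D-⊔ (off-hit b e)))) , a′
  AgreeD-bump {s = cl r ∷ s} {cl r′ ∷ s′} {f} {y} (cl≢ _ b) e (h , a) with a′ ← AgreeD-bump b e a =
    trans (sym (m≥n⇒m⊔n≡m (+[]-≤ {#op s} (Bump-#op b) 0))) (trans (cong₂ _⊔_ (AgreeD-top s a′)
      (trans h (cong (λ z → D (suc z) f (suc y)) (sym (Bump-length b)))))
      (sym (D-⊔ (off-hit b e)))) , a′

  AgreeD-base : ∀ {y} s → (∀ d → #op s d ≡ 0) → AgreeD 0 y s
  AgreeD-base []         z = tt
  AgreeD-base (op c ∷ s) z with () ← trans (sym (cong (_+ #op s c) (δ-refl c))) (z c)
  AgreeD-base (cl r ∷ s) z = z 0 , AgreeD-base s z

  AgreeD-flush : ∀ {m s q y} (fl : Flush m s q) → ConsF σ y fl → (∀ d → #op q d ≡ 0) → AgreeD m y s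
  AgreeD-flush {s = s} done c z = AgreeD-base s z
  AgreeD-flush (b ∷⟨ _ ⟩ fl) ((e , _) , c) z = AgreeD-bump b e (AgreeD-flush fl c z)

-- The involution of a run

Involutive : (ℕ → ℕ) → Set
Involutive τ = ∀ x → τ (τ x) ≡ x

link : (ℕ → ℕ) → ℕ → ℕ → ℕ → ℕ
link τ a y z with z ≟ a | z ≟ y
... | yes _ | _     = y
... | no  _ | yes _ = a
... | no  _ | no  _ = τ z

link-a : ∀ τ a y → link τ a y a ≡ y
link-a τ a y with a ≟ a | a ≟ y
... | yes _ | _ = refl
... | no  p | _ = ⊥-elim (p refl)

link-y : ∀ τ a y → a ≢ y → link τ a y y ≡ a
link-y τ a y n with y ≟ a | y ≟ y
... | yes e | _     = ⊥-elim (n (sym e))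
... | no  _ | yes _ = refl
... | no  _ | no  p = ⊥-elim (p refl)

link-other : ∀ τ a y {z} → z ≢ a → z ≢ y → link τ a y z ≡ τ z
link-other τ a y {z} p q with z ≟ a | z ≟ y
... | yes e | _     = ⊥-elim (p e)
... | no  _ | yes e = ⊥-elim (q e)
... | no  _ | no  _ = refl

link-Involutive : ∀ {τ a y} → Involutive τ → a ≢ y → τ a ≡ a → τ y ≡ y → Involutive (link τ a y)
link-Involutive {τ} {a} {y} i n ea ey z = go (z ≟ a) (z ≟ y)
  where
  go : _ → _ → link τ a y (link τ a y z) ≡ z
  go (yes refl) _          = trans (cong (link τ a y) (link-a τ a y)) (link-y τ a y n)
  go (no  _)    (yes refl) = trans (cong (link τ a y) (link-y τ a y n)) (link-a τ a y)
  go (no  p)    (no  q)    = trans (cong (link τ a y) (link-other τ a y p q)) (trans (link-other τ a y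
    (λ e → p (trans (sym (i z)) (trans (cong τ e) ea)))
    (λ e → q (trans (sym (i z)) (trans (cong τ e) ey)))) (i z))

Each : (ℕ → Set) → (ℕ → Set) → State → Set
Each P R []         = ⊤
Each P R (op _ ∷ s) = P (length s) × Each P R s
Each P R (cl _ ∷ s) = R (length s) × Each P R s

Each-map : ∀ {P P′ R R′} s → (∀ x → x < length s → P x → P′ x) → (∀ x → x < length s → R x → R′ x) →
           Each P R s → Each P′ R′ s
Each-map []         f g e       = tt
Each-map (op c ∷ s) f g (p , e) = f _ ≤-refl p , Each-map s (λ x q → f x (m<n⇒m<1+n q)) (λ x q → g x (m<n⇒m<1+n q)) e
Each-map (cl r ∷ s) f g (p , e) = g _ ≤-refl p , Each-map s (λ x q → f x (m<n⇒m<1+n q)) (λ x q → g x (m<n⇒m<1+n q)) e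

Each-bump : ∀ {P P′ R R′ c ρ s s′} (b : Bump c ρ s s′) → P′ (hitPos b) →
            (∀ x → x < length s → x ≢ hitPos b → P x → P′ x) →
            (∀ x → x < length s → x ≢ hitPos b → R x → R′ x) →
            Each P R s′ → Each P′ R′ s
Each-bump (hit {s}) h f g (_ , e) =
  h , Each-map s (λ x q → f x (m<n⇒m<1+n q) (<⇒≢ q)) (λ x q → g x (m<n⇒m<1+n q) (<⇒≢ q)) e
Each-bump {P = P} {P′} (op≡ b) h f g (p , e) =
  f _ ≤-refl (λ z → <⇒≢ (hitPos-< b) (sym z)) (subst P (sym (Bump-length b)) p) ,
  Each-bump b h (λ x q → f x (m<n⇒m<1+n q)) (λ x q → g x (m<n⇒m<1+n q)) e
Each-bump {P = P} (op≢ _ b) h f g (p , e) =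
  f _ ≤-refl (λ z → <⇒≢ (hitPos-< b) (sym z)) (subst P (sym (Bump-length b)) p) ,
  Each-bump b h (λ x q → f x (m<n⇒m<1+n q)) (λ x q → g x (m<n⇒m<1+n q)) e
Each-bump {R = R} (cl≡ b) h f g (p , e) =
  g _ ≤-refl (λ z → <⇒≢ (hitPos-< b) (sym z)) (subst R (sym (Bump-length b)) p) ,
  Each-bump b h (λ x q → f x (m<n⇒m<1+n q)) (λ x q → g x (m<n⇒m<1+n q)) e
Each-bump {R = R} (cl≢ _ b) h f g (p , e) =
  g _ ≤-refl (λ z → <⇒≢ (hitPos-< b) (sym z)) (subst R (sym (Bump-length b)) p) ,
  Each-bump b h (λ x q → f x (m<n⇒m<1+n q)) (λ x q → g x (m<n⇒m<1+n q)) e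

Each-hit : ∀ {P R c ρ s s′} (b : Bump c ρ s s′) → Each P R s′ → R (hitPos b)
Each-hit hit       (p , _) = p
Each-hit (op≡ b)   (_ , e) = Each-hit b e
Each-hit (op≢ _ b) (_ , e) = Each-hit b e
Each-hit (cl≡ b)   (_ , e) = Each-hit b e
Each-hit (cl≢ _ b) (_ , e) = Each-hit b e

_extends_ : (ℕ → ℕ) → (ℕ → ℕ) → Set
σ extends τ = ∀ x → τ x ≢ x → σ x ≡ τ x

link-extends : ∀ {τ a y} → τ a ≡ a → τ y ≡ y → link τ a y extends τ
link-extends {τ} {a} {y} ea ey x n = link-other τ a y (λ { refl → n ea }) (λ { refl → n ey })

ConsF-extends : ∀ {σ τ m s q y} (fl : Flush m s q) → length s ≤ y → σ extends τ → ConsF τ y fl → ConsF σ y fl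
ConsF-extends done          p e c = tt
ConsF-extends {τ = τ} {s = s} (b ∷⟨ _ ⟩ fl) p e ((c₁ , c₂) , c) =
  (trans (e _ (λ z → <⇒≢ lt (trans (sym z) c₁))) c₁ ,
   trans (e _ (λ z → <⇒≢ lt (trans (sym c₂) z))) c₂) ,
  ConsF-extends fl (m≤n⇒m≤1+n (subst (_≤ _) (Bump-length b) p)) e c
  where lt = <-≤-trans (hitPos-< b) p

private
  -- `τ` holds the arcs of later steps only: open letters have their partner ahead, while closed
  -- ones are still fixed and free to be linked when the construction comes back to their step.
  OpenAbove : (ℕ → ℕ) → ℕ → State → Set
  OpenAbove τ y = Each (λ x → y ≤ τ x) (λ x → τ x ≡ x)

  noOp-Each : ∀ {P R} s → (∀ d → #op s d ≡ 0) → (∀ x → R x) → Each P R s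
  noOp-Each []         z r = tt
  noOp-Each (op c ∷ s) z r with () ← trans (sym (cong (_+ #op s c) (δ-refl c))) (z c)
  noOp-Each (cl c ∷ s) z r = r (length s) , noOp-Each s z r

  OpenAbove-bump : ∀ {c ρ s s′ τ y} (b : Bump c ρ s s′) → length s ≤ y → OpenAbove τ (suc y) s′ →
                   OpenAbove (link τ (hitPos b) y) y s
  OpenAbove-bump {s = s} {τ = τ} {y} b p = Each-bump b (≤-reflexive (sym (link-a τ (hitPos b) y)))
    (λ x q n o → subst (y ≤_) (sym (link-other τ (hitPos b) y n (<⇒≢ (<-≤-trans q p)))) (<⇒≤ o))
    (λ x q n o → trans (link-other τ (hitPos b) y n (<⇒≢ (<-≤-trans q p))) o)

-- The construction starts from the identity at the end. The positions from `length s` to `y` belong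
-- to closing steps not yet reached on the way back, so they must still be fixed.
flush-involution : ∀ {m s q} (fl : Flush m s q) → (∀ d → #op q d ≡ 0) → ∀ y → length s ≤ y →
  ∃ λ τ → Involutive τ × OpenAbove τ y s × (∀ z → length s ≤ z → z < y → τ z ≡ z) ×
          (∀ z → m + y ≤ z → τ z ≡ z) × ConsF τ y fl
flush-involution {q = q} done z y p =
  (λ x → x) , (λ _ → refl) , noOp-Each q z (λ _ → refl) , (λ _ _ _ → refl) , (λ _ _ → refl) , tt
flush-involution {suc m} {s} (b ∷⟨ _ ⟩ fl) z y p
  with τ , i , o , f , F , c ← flush-involution fl z (suc y) (m≤n⇒m≤1+n (subst (_≤ y) (Bump-length b) p))
  = let τa = Each-hit b o
        τy = f y (subst (_≤ y) (Bump-length b) p) ≤-refl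
    in link τ a y , link-Involutive i (<⇒≢ a<y) τa τy , OpenAbove-bump b p o ,
    (λ x q r → trans (link-other τ a y (λ e → <⇒≱ (hitPos-< b) (subst (length s ≤_) e q)) (<⇒≢ r))
                 (f x (subst (_≤ x) (Bump-length b) q) (m<n⇒m<1+n r))) ,
    (λ x q → trans (link-other τ a y (λ e → <⇒≱ a<y (≤-trans (≤-trans (m≤n+m y (suc m)) q) (≤-reflexive e)))
                     (λ e → <⇒≱ (m<n+m y (s≤s z≤n)) (≤-trans q (≤-reflexive e))))
               (F x (subst (_≤ x) (sym (+-suc m y)) q))) ,
    (link-a τ a y , link-y τ a y (<⇒≢ a<y)) ,
    ConsF-extends fl (m≤n⇒m≤1+n (subst (_≤ y) (Bump-length b) p)) (link-extends τa τy) c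
  where
  a   = hitPos b
  a<y : a < y
  a<y = <-≤-trans (hitPos-< b) p

run-involution : ∀ {l s} (r : Run l s) τ → Involutive τ → OpenAbove τ (length s) s →
  ∃ λ σ → Involutive σ × Cons σ r × σ extends τ × (∀ z → length s ≤ z → σ z ≡ τ z)
run-involution start τ i o = τ , i , tt , (λ _ _ → refl) , λ _ _ → refl
run-involution (up {s = s} r _ _) τ i (p , o)
  with σ , j , c , e , F ← run-involution r τ i (Each-map s (λ _ _ → <⇒≤) (λ _ _ z → z) o)
  = σ , j , (c , subst (length s <_) (sym (F (length s) ≤-refl)) p) , e , λ z q → F z (<⇒≤ q)
run-involution (down {s = s} {s′} r _ _ b) τ i (p , o)
  with σ , j , c , e , F ← run-involution r (link τ (hitPos b) (length s))
         (link-Involutive i (<⇒≢ (hitPos-< b)) (Each-hit b o) (subst (λ z → τ z ≡ z) (sym (Bump-length b)) p))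
         (OpenAbove-bump b ≤-refl (subst (λ z → OpenAbove τ (suc z) s′) (sym (Bump-length b)) o))
  = σ , j ,
    (c , trans (e a (λ z → a≢y (trans (sym z) (link-a τ a y)))) (link-a τ a y) ,
         trans (F y ≤-refl) (link-y τ a y a≢y)) ,
    (λ x n → trans (e x (λ z → n (trans (sym (other x n)) z))) (other x n)) ,
    (λ z q → trans (F z (<⇒≤ (subst (_< z) (sym (Bump-length b)) q)))
               (link-other τ a y (λ x → <⇒≱ (<-trans a<y (subst (_< z) (sym (Bump-length b)) q)) (≤-reflexive x))
                 (λ x → <⇒≢ q (trans (sym (Bump-length b)) (sym x)))))
  where
  a   = hitPos b
  y   = length s
  a<y = hitPos-< b
  a≢y = <⇒≢ a<y
  other : ∀ x → τ x ≢ x → link τ a y x ≡ τ x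
  other = link-extends (Each-hit b o) (subst (λ z → τ z ≡ z) (sym (Bump-length b)) p)

involution : ∀ {l s m q} (r : Run l s) (fl : Flush m s q) → (∀ d → #op q d ≡ 0) →
  ∃ λ σ → Involutive σ × Cons σ r × ConsF σ (length s) fl × (∀ z → m + length s ≤ z → σ z ≡ z)
involution {s = s} {m} r fl z
  with τ , i , o , _ , F , c ← flush-involution fl z (length s) ≤-refl
  with σ , j , c′ , e , G ← run-involution r τ i o
  = σ , j , c′ , ConsF-extends fl ≤-refl e c ,
    λ x p → trans (G x (≤-trans (m≤n+m (length s) m) p)) (F x p)

fixpoint-free : ∀ {σ l s} (r : Run l s) → Cons σ r → ∀ x → x < length s → σ x ≢ x
fixpoint-free (up {s = s} r _ _) (c , p) x q with x ≟ length s
... | yes refl = λ e → <⇒≢ p (sym e)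
... | no  n    = fixpoint-free r c x (≤∧≢⇒< (≤-pred q) n)
fixpoint-free (down {s = s} r _ _ b) (c , _ , e) x q with x ≟ length s
... | yes refl = λ e′ → <⇒≢ (hitPos-< b) (trans (sym e) e′)
... | no  n    = fixpoint-free r c x (≤∧≢⇒< (≤-pred (subst (λ z → x < suc z) (sym (Bump-length b)) q)) n)

-- Comparison of heights

module Heights {l s m q} (r : Run l s) (fl : Flush m s q) (ql : ClLat q) (qz : ∀ d → #op q d ≡ 0)
               (sm : #op s 0 ≤ 1) (σ : ℕ → ℕ) (σσ : Involutive σ) (cr : Cons σ r) (cf : ConsF σ (length s) fl)
               (fix : ∀ z → m + length s ≤ z → σ z ≡ z) where

  private
    n   = length s
    N   = m + n
    n≤N : n ≤ N
    n≤N = m≤n+m n m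
    σ<N : ∀ x → x < N → σ x < N
    σ<N x p with σ x <? N
    ... | yes t = t
    ... | no  t = ⊥-elim (<⇒≱ p (subst (N ≤_) (trans (sym (fix (σ x) (≮⇒≥ t))) (σσ x)) (≮⇒≥ t)))

  open Grid σ σσ
  open Rows σ σσ n N n≤N σ<N

  agreeH : Agree N q
  agreeH = Agree-flush fl cf (Agree-run r cr)

  agreeD : AgreeD m n s
  agreeD = AgreeD-flush fl cf qz

  -- The longest nest of arcs from below `n` to `n` or beyond is the first column of the final open
  -- letters, which form a single row.
  no-nest : ¬ Nest n n 2
  no-nest t = <⇒≱ (Nest⇒D m (+-comm n m) ≤-refl t) (subst (_≤ 1) (AgreeD-top s agreeD) sm)

  -- `AgreeD` on the whole state gives the height of the diagram at time `i` as the longest nest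
  -- across `i`; `j + f` counts the rows from `i` to the end.
  run-D : ∀ k {l s f} (r : Run l s) → Cons σ r → AgreeD f (length s) s →
          (All (λ p → length p ≤ k) l → ∀ i j → i + j ≡ length s → D i (j + f) i ≤ k) ×
          ((∀ i j → i + j ≡ length s → D i (j + f) i ≤ k) → All (λ p → length p ≤ k) l)
  run-D′ : ∀ k {xs l s} {s₀ : State} {f} (r : Run l s) → Cons σ r → AgreeD (suc f) (length s) s →
           length xs ≡ D (length s₀) f (length s₀) → length s₀ ≡ suc (length s) →
           (All (λ p → length p ≤ k) (xs ∷ l) → ∀ i j → i + j ≡ length s₀ → D i (j + f) i ≤ k) ×
           ((∀ i j → i + j ≡ length s₀ → D i (j + f) i ≤ k) → All (λ p → length p ≤ k) (xs ∷ l))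
  run-D k start c a = (λ { _ zero zero _ → z≤n }) , λ _ → z≤n ∷ []
  run-D k R@(up {c = c} {s = s} r _ (_ , d)) (c′ , p) a = run-D′ k {s₀ = op c ∷ s} r c′ (AgreeD-idle s (<⇒≤ p) (proj₂ a))
    (trans (sym (col-0 d)) (trans (sym (Run-col R 0)) (AgreeD-top (op c ∷ s) a))) refl
  run-D k {f = f} R@(down {ρ = ρ} {s = s} {s′} r _ (_ , d) b) (c′ , e , _) a = run-D′ k {s₀ = cl (suc ρ) ∷ s′} r c′
    (AgreeD-bump b e (subst (λ z → AgreeD f (suc z) s′) (sym (Bump-length b)) (proj₂ a)))
    (trans (sym (col-0 d)) (trans (sym (Run-col R 0)) (AgreeD-top (cl (suc ρ) ∷ s′) a))) (cong suc (sym (Bump-length b)))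
  run-D′ k {s = s} {s₀} {f} r c a e e′ with F , G ← run-D k r c a =
    (λ { (p ∷ ps) i zero    x → subst (λ z → D z f z ≤ k) (trans (sym x) (+-identityʳ i)) (subst (_≤ k) e p)
       ; (p ∷ ps) i (suc j) x → subst (λ z → D i z i ≤ k) (+-suc j f)
                                  (F ps i j (suc-injective (trans (sym (+-suc i j)) (trans x e′)))) }) ,
    λ h → subst (_≤ k) (sym e) (h (length s₀) 0 (+-identityʳ _)) ∷
          G (λ i j x → subst (λ z → D i z i ≤ k) (sym (+-suc j f)) (h i (suc j) (trans (+-suc i j) (trans (cong suc x) (sym e′)))))

  -- By the ballot condition a letter in row `suc c` has an earlier one in row `c`, so an occupied
  -- row `h` yields one letter of each row down to it, in order. The subsequence is assembled from
  -- its right end, with `xs` the part already passed.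
  lattice-Inc : ∀ s → ClLat s → Agree N s → length s ≤ n → ∀ h → 0 < #cl s h → ∀ {L xs} →
                Inc (suc (N + suc h)) L xs → Inc 0 (suc h + L) (seg (letter N) 0 (length s) ++ xs)
  lattice-Inc (l ∷ s) lat (e , a) p h g {L} {xs} i =
    subst (Inc 0 (suc h + L)) (sym (seg-∷ʳ (letter N) 0 (length s) xs)) (go l lat g (trans (letter-old (σ<N _ (<-≤-trans p n≤N))) (cong (N +_) (sym e))))
    where
    go : ∀ l → ClLat (l ∷ s) → 0 < #cl (l ∷ s) h → letter N (length s) ≡ N + code l →
         Inc 0 (suc h + L) (seg (letter N) 0 (length s) ++ letter N (length s) ∷ xs)
    go (op c) lat g e = lattice-Inc s lat a (<⇒≤ p) h g (skip i)
    go (cl c) (ad , lat) g e with h ≟ c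
    ... | no  d    = lattice-Inc s lat a (<⇒≤ p) h (subst (λ z → 0 < z + #cl s h) (δ-≢ d) g) (skip i)
    go (cl zero)    (ad , lat) g e | yes refl =
      seg-skip (letter N) 0 (length s) (take z≤n (subst (λ z → Inc (suc z) L xs) (sym e) i))
    go (cl (suc c)) (ad , lat) g e | yes refl =
      Inc-cong (cong suc (+-suc c L))
        (lattice-Inc s lat a (<⇒≤ p) c (≤-trans (s≤s z≤n) ad)
          (take (≤-reflexive (trans (sym (+-suc N (suc c))) (sym e))) (subst (λ z → Inc (suc z) L xs) (sym e) i)))

  label-bound : ∀ {h} s → All (ClBelow h) s → (∀ d → #op s d ≡ 0) → Agree N s →
                ∀ x → x < length s → 0 < H x N × H x N ≤ h
  label-bound (op c ∷ s) _       z _       x p with () ← trans (sym (cong (_+ #op s c) (δ-refl c))) (z c)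
  label-bound {h} (cl c ∷ s) (b ∷ bs) z (e , a) x p with x ≟ length s
  ... | yes refl = subst (0 <_) e (s≤s z≤n) , subst (_≤ h) e b
  ... | no  n    = label-bound s bs z a x (≤∧≢⇒< (≤-pred p) n)

  All-seg : ∀ {P : ℕ → Set} f x k → (∀ z → z < x + k → P (f z)) → All P (seg f x k)
  All-seg f x zero    g = []
  All-seg f x (suc k) g = g x (m<m+n x (s≤s z≤n)) ∷ All-seg f (suc x) k (λ z p → g z (subst (z <_) (sym (+-suc x k)) p))

  Inc-last : ∀ {b u L xs} → All (_≤ u) xs → Inc b (suc L) xs → b + L ≤ u
  Inc-last (p ∷ a) (skip i)                     = Inc-last a i
  Inc-last {b} {u} {zero}  (p ∷ a) (take q i) = subst (_≤ u) (sym (+-identityʳ b)) (≤-trans q p)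
  Inc-last {b} {u} {suc L} {x ∷ _} (p ∷ a) (take q i) =
    ≤-trans (subst (_≤ suc (x + L)) (sym (+-suc b L)) (s≤s (+-monoˡ-≤ L q))) (Inc-last a i)

  private
    n≡ : length s ≡ length q
    n≡ = Flush-length fl

    below⇒ : ∀ {L h} → All (ClBelow h) q → Inc 0 (suc L) (rowWord N) → L < h
    -- All letters of the last word lie between `N + 1` and `N + h`, which leaves room for `h`
    -- increasing ones.
    below⇒ {L} {h} B i = +-cancelˡ-≤ N _ _ (subst (_≤ N + h) (trans (+-assoc N 1 L) refl)
      (Inc-last (All-seg (letter N) 0 n (λ x p → subst (_≤ N + h) (sym (old x p)) (+-monoʳ-≤ N (proj₂ (lb x p)))))
        (Inc-raise (All-seg (letter N) 0 n (λ x p → inj₂ (subst (N + 1 ≤_) (sym (old x p)) (+-monoʳ-≤ N (proj₁ (lb x p)))))) i)))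
      where
      lb : ∀ x → x < n → 0 < H x N × H x N ≤ h
      lb x p = label-bound q B qz agreeH x (subst (x <_) n≡ p)
      old : ∀ x → x < n → letter N x ≡ N + H x N
      old x p = letter-old (σ<N x (<-≤-trans p n≤N))

    ⇒below : ∀ h → #cl q h ≡ 0 → All (ClBelow h) q
    ⇒below h e = go q (λ d p → n≤0⇒n≡0 (subst (#cl q d ≤_) e (anti d p)))
      where
      anti : ∀ d → h ≤ d → #cl q d ≤ #cl q h
      anti d p with ≤⇒≤′ p
      ... | ≤′-refl     = ≤-refl
      ... | ≤′-step {d′} p′ = ≤-trans (OpLat⇒Antitone (dual q) ql d′) (anti d′ (≤′⇒≤ p′))
      go : ∀ s → (∀ d → h ≤ d → #cl s d ≡ 0) → All (ClBelow h) s
      go []         z = []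
      go (op c ∷ s) z = tt ∷ go s z
      go (cl c ∷ s) z = below (c <? h) ∷ go s (λ d p → m+n≡0⇒n≡0 (δ d c) (z d p))
        where
        below : _ → c < h
        below (yes p) = p
        below (no  p) with () ← trans (sym (cong (_+ #cl s c) (δ-refl c))) (z c (≮⇒≥ p))

  heights⇒ : ∀ k → All (λ p → length p ≤ k) l → All (ClBelow (k + k)) q
  heights⇒ k A with #cl q (k + k) in e
  ... | zero  = ⇒below (k + k) e
  ... | suc _ = ⊥-elim (<⇒≱ (Nest⇒D (j + m) lenN i≤n nest) (proj₁ (run-D k r cr agreeD) A i j i+j))
    where
    inc : Inc 0 (suc (k + k)) (rowWord N)
    inc = subst (Inc 0 _) (trans (++-identityʳ _) (cong (seg (letter N) 0) (sym n≡)))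
            (Inc-cong (+-identityʳ _) (lattice-Inc q ql agreeH (≤-reflexive (sym n≡)) (k + k)
              (subst (0 <_) (sym e) (s≤s z≤n)) {0} {[]} stop))
    -- Written so that `k` letters precede the middle one; the side of the diagonal on which the
    -- middle letter lies selects the half to be used.
    chain : Chain 0 N (k + suc k)
    chain = subst (Chain 0 N) (sym (+-suc k k)) (Inc⇒Chain 0 n N refl ≤-refl
              (subst (λ z → Inc z (suc (k + k)) (rowWord 0)) (sym (n∸n≡0 N)) (proj₂ (rows N ≤-refl) inc)))
    mid  = Chain⇒Nest-mid (fixpoint-free r cr) 0 k k refl stop chain
    i    = proj₁ mid
    i≤n  = proj₁ (proj₂ mid)
    nest = proj₂ (proj₂ mid)
    j    = n ∸ i
    i+j : i + j ≡ n
    i+j = m+[n∸m]≡n i≤n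
    lenN : i + (j + m) ≡ N
    lenN = trans (sym (+-assoc i j m)) (trans (cong (_+ m) i+j) (+-comm n m))

  heights⇐ : ∀ k → All (ClBelow (k + k)) q → All (λ p → length p ≤ k) l
  heights⇐ k B = proj₂ (run-D k r cr agreeD) λ i j e → ≮⇒≥ λ p →
    <-irrefl refl (below⇒ B (proj₁ (rows N ≤-refl)
      (subst (λ z → Inc z (suc (k + k)) (rowWord 0)) (n∸n≡0 N) (Chain⇒Inc 0 n N refl
        (Nest⇒Chain (fixpoint-free r cr) no-nest (≤-trans (m≤m+n i j) (≤-reflexive e)) (D⇒Nest i (j + m) i (suc k) p))))))

-- The correspondence

col-oneRow : ∀ m d → col (oneRow m) d ≡ ind m d
col-oneRow zero    d = refl
col-oneRow (suc m) d with d <? suc m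
... | yes p = trans (col-∷-> {suc m} {[]} p) (sym (ind-< p))
  where
  ind-< : ∀ {m d} → d < m → ind m d ≡ 1
  ind-< {suc m} {zero}  p       = refl
  ind-< {suc m} {suc d} (s≤s p) = ind-< p
... | no  p = trans (col-∷-≤ {suc m} {[]} (≮⇒≥ p)) (sym (ind-≥ (≮⇒≥ p)))
  where
  ind-≥ : ∀ {m d} → m ≤ d → ind m d ≡ 0
  ind-≥ z≤n     = refl
  ind-≥ (s≤s p) = ind-≥ p

oneRow-Desc : ∀ m → Desc m (oneRow m)
oneRow-Desc zero    = []
oneRow-Desc (suc m) = cons (s≤s z≤n) ≤-refl []

ind-0 : ∀ m → ind m 0 ≤ 1
ind-0 zero    = z≤n
ind-0 (suc m) = ≤-refl

noOp⇒OpLat : ∀ s → (∀ d → #op s d ≡ 0) → OpLat s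
noOp⇒OpLat []         z = tt
noOp⇒OpLat (op c ∷ s) z with () ← trans (sym (cong (_+ #op s c) (δ-refl c))) (z c)
noOp⇒OpLat (cl r ∷ s) z = noOp⇒OpLat s z

-- The bijection as a relation: existence and uniqueness on either side suffice, so no two functions
-- have to be shown inverse to each other. The height bound is no part of it and is compared
-- separately in `Corr-height`.
data Corr (m : ℕ) (xs : List (List ℕ)) (rows : List (List ℕ)) : Set where
  corr : ∀ {s q} → Run (reverse xs) s → Flush m s q → Tab rows q → Corr m xs rows

Corr-det : ∀ {m xs rows rows′} → Corr m xs rows → Corr m xs rows′ → rows ≡ rows′
Corr-det (corr r f t) (corr r′ f′ t′)
  with refl ← Run-det r r′ with refl ← Flush-det f f′ = Tab-det t t′

Corr-det⁻ : ∀ {m xs xs′ rows} → Corr m xs rows → Corr m xs′ rows → xs ≡ xs′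
Corr-det⁻ (corr r f t) (corr r′ f′ t′)
  with refl ← Tab-det⁻ t t′ with refl ← Flush-det⁻ f f′ = reverse-injective (Run-det⁻ r r′)

isSYTₘ : ℕ → ℕ → ℕ → List (List ℕ) → Bool
isSYTₘ n h m rows = isSYT n rows ∧ (height (shape rows) ≤ᵇ h) ∧ (oddColumns (shape rows) ≡ᵇ m)

2*≡ : ∀ k → 2 * k ≡ k + k
2*≡ k = cong (k +_) (+-identityʳ k)

Tab-alt : ∀ {rows q} → Tab rows q →
          Bounded (length (shape rows)) (#cl q) × oddColumns (shape rows) ≡ alt (length (shape rows)) (#cl q)
Tab-alt {rows} {q} t = (λ d p → trans (Tab-nth t d) (Bounded-nth (shape rows) d p)) ,
  trans (oddColumns≡alt _ (shape rows) (proj₂ (T⇒Part (proj₁ (YT⇒T (Tab-YT t))))) (Bounded-nth (shape rows)))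
    (alt-cong (length (shape rows)) (λ j _ → sym (Tab-nth t (dbl j)) , sym (Tab-nth t (suc (dbl j)))))

Corr-height : ∀ {k m l s q rows} → Run (oneRow m ∷ l) s → Flush m s q → Tab rows q →
              (All (λ p → length p ≤ k) (oneRow m ∷ l) → height (shape rows) ≤ 2 * k) ×
              (height (shape rows) ≤ 2 * k → All (λ p → length p ≤ k) (oneRow m ∷ l))
Corr-height {k} {m} {l} {s} {q} {rows} r f t with involution r f (Tab-noOp t)
... | σ , σσ , cr , cf , fix =
  (λ A → subst₂ _≤_ (sym (length-map length rows)) (sym (2*≡ k)) (Tab-height⁻ t (heights⇒ k A))) ,
  (λ h → heights⇐ k (Tab-height t (subst₂ _≤_ (length-map length rows) (2*≡ k) h)))
  where
  open Heights r f (Tab-ClLat t) (Tab-noOp t)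
    (subst (_≤ 1) (sym (trans (Run-col r 0) (col-oneRow m 0))) (ind-0 m)) σ σσ cr cf fix

osc⇒syt : ∀ n k m xs → length xs ≡ suc n → T (isOscillating k (oneRow m) xs) →
          ∃ λ rows → T (isSYTₘ n (2 * k) m rows) × Corr m xs rows
osc⇒syt n k m xs len o
  with l , s , e , r , A ← osc⇒run k (oneRow m) xs o
  with q , f , z , lq , am ← flush m s (Run-Good r) (λ d → trans (Run-col r d) (col-oneRow m d))
  with rows , t ← tab q lq z
  with refl ← suc-injective (trans (cong suc (sym (Flush-length f))) (trans (sym (Run-length r))
                (trans (cong length (sym e)) (trans (length-reverse xs) len))))
  = rows , T∧ {isSYT (length q) rows} (tab⇒syt t)
       (T∧ {height (shape rows) ≤ᵇ 2 * k} (≤⇒≤ᵇ (proj₁ (Corr-height r f t) A))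
         (≡⇒≡ᵇ (oddColumns (shape rows)) m (trans (proj₂ (Tab-alt t)) (am _ (proj₁ (Tab-alt t)))))) ,
     corr (subst (λ l → Run l s) (sym e) r) f t

syt⇒osc : ∀ n k m rows → T (isSYTₘ n (2 * k) m rows) →
          ∃ λ xs → length xs ≡ suc n × T (isOscillating k (oneRow m) xs) × Corr m xs rows
syt⇒osc n k m rows τ
  with t₁ , t′ ← T∧⁻ {isSYT n rows} τ
  with t₂ , t₃ ← T∧⁻ {height (shape rows) ≤ᵇ 2 * k} t′
  with q , len , t ← syt⇒tab n rows t₁
  with s , f , g , ops ← unflush m (length (shape rows)) q (proj₁ (Tab-alt t))
         (trans (sym (proj₂ (Tab-alt t))) (≡ᵇ⇒≡ (oddColumns (shape rows)) m t₃))
         (Tab-noOp t) (noOp⇒OpLat q (Tab-noOp t)) (Tab-ClLat t)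
  with x , l , r ← run s g
  with refl ← col-injective (proj₂ (Run-Part r)) (oneRow-Desc m)
         (λ d → trans (sym (Run-col r d)) (trans (ops d) (sym (col-oneRow m d))))
  = reverse (oneRow m ∷ l) ,
    trans (length-reverse (oneRow m ∷ l)) (trans (Run-length r) (cong suc (trans (Flush-length f) len))) ,
    run⇒osc k (oneRow m) l r (proj₂ (Corr-height r f t) (≤ᵇ⇒≤ (height (shape rows)) (2 * k) t₂)) ,
    corr (subst (λ l → Run l s) (sym (reverse-involutive (oneRow m ∷ l))) r) f t

toVec : ∀ {n} (xs : List (List ℕ)) → length xs ≡ n → ∃ λ (v : Vec (List ℕ) n) → toList v ≡ xs
toVec xs refl = fromList xs , toList∘fromList xs

Σ-≡ : ∀ {A : Set} {p : A → Bool} {u v : Σ A (λ a → T (p a))} → proj₁ u ≡ proj₁ v → u ≡ v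
Σ-≡ {u = a , t} {.a , t′} refl = cong (a ,_) (T-irrelevant t t′)

correspondence⇒⤖ : ∀ {A B : Set} (R : A → B → Set) → (∀ a → ∃ λ b → R a b) → (∀ b → ∃ λ a → R a b) →
                   (∀ {a b b′} → R a b → R a b′ → b ≡ b′) → (∀ {a a′ b} → R a b → R a′ b → a ≡ a′) → A ⤖ B
correspondence⇒⤖ R f g det det⁻ = mk⤖ {to = λ a → proj₁ (f a)}
  ( (λ {a} {a′} e → det⁻ (proj₂ (f a)) (subst (R a′) (sym e) (proj₂ (f a′))))
  , (λ b → proj₁ (g b) , λ { refl → det (proj₂ (f (proj₁ (g b)))) (proj₂ (g b)) }) )

OscTableaux-≡ : ∀ {n k m} {o o′ : OscTableaux n k m} → toList (proj₁ o) ≡ toList (proj₁ o′) → o ≡ o′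
OscTableaux-≡ {n} {k} {m} {v , _} {v′ , _} e =
  Σ-≡ {p = λ v → isOscillating k (oneRow m) (toList v)} (trans (sym (cast-is-id refl v)) (toList-injective refl v v′ e))

SYTs-≡ : ∀ {n h m} {s s′ : SYTs n h m} → proj₁ s ≡ proj₁ s′ → s ≡ s′
SYTs-≡ {n} {h} {m} = Σ-≡ {p = isSYTₘ n h m}

osc⇒SYTs : ∀ n k m (o : OscTableaux n k m) → ∃ λ (s : SYTs n (2 * k) m) → Corr m (toList (proj₁ o)) (proj₁ s)
osc⇒SYTs n k m (v , t) = (proj₁ r , proj₁ (proj₂ r)) , proj₂ (proj₂ r)
  where r = osc⇒syt n k m (toList v) (length-toList v) t

syt⇒OscTableaux : ∀ n k m (s : SYTs n (2 * k) m) →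
                  ∃ λ (o : OscTableaux n k m) → Corr m (toList (proj₁ o)) (proj₁ s)
syt⇒OscTableaux n k m (rows , t) = pack (syt⇒osc n k m rows t)
  where
  pack : (∃ λ xs → length xs ≡ suc n × T (isOscillating k (oneRow m) xs) × Corr m xs rows) →
         ∃ λ (o : OscTableaux n k m) → Corr m (toList (proj₁ o)) rows
  pack (xs , len , t′ , c) with v , refl ← toVec xs len = (v , t′) , c

theorem1 : (n k m : ℕ) → 1 ≤ n → 1 ≤ k →
    OscTableaux n k m ⤖ SYTs n (2 * k) m
theorem1 n k m _ _ = correspondence⇒⤖ (λ o s → Corr m (toList (proj₁ o)) (proj₁ s))
  (osc⇒SYTs n k m) (syt⇒OscTableaux n k m)
  (λ r r′ → SYTs-≡ (Corr-det r r′)) (λ r r′ → OscTableaux-≡ (Corr-det⁻ r r′))
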